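{- For each $\theta_0\in\mathcal{S}$, there are infinitely many $M\in\mathbb{N}$ for which $\theta_0=\operatorname{argmin}_{\theta\in\mathcal{S}}D_M(\theta)$, where elements $\theta,\theta'$ of $\mathcal{S}$ with $\theta-\theta'\in\mathbb{Z}$ or $\theta+\theta'\in\mathbb{Z}$ are identified; that is, there are infinitely many $M\in\mathbb{N}$ such that $D_M(\theta_0)<D_M(\theta)$ for every $\theta\in\mathcal{S}$ with $\theta-\theta_0\notin\mathbb{Z}$ and $\theta+\theta_0\notin\mathbb{Z}$.
   Context: For $\theta\in\mathbb{R}$ and an integer $m\ge 0$, let $d_\theta(m)=\sup\{|I| : I\subset\mathbb{R}\text{ an interval},\ (I+\mathbb{Z})\cap\{0,\theta,2\theta,\dots,m\theta\}=\emptyset\}$, where $|I|$ is the length of $I$. $\mathbb{N}$ is the set of positive integers. Let $D(\theta)=\sup_{m\in\mathbb{N}}(m+1)\,d_\theta(m)$ and, for $M\in\mathbb{N}$, $D_M(\theta)=\max_{1\le m\le M}(m+1)\,d_\theta(m)$. Let $\mathcal{S}=\{\theta\in\mathbb{R}: D(\theta)=1+\frac{2}{\sqrt5}\}$. Note that $d_\theta(m)$ is unchanged when $\theta$ is replaced by $\pm\theta+k$ with $k\in\mathbb{Z}$. -}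

module Defs where

open import Algebra.Bundles using (CommutativeRing)
open import Data.Bool.Base using (Bool; true; false; if_then_else_)
open import Data.Empty using (⊥)
open import Data.Integer.Base as ℤ using (ℤ; -[1+_])
open import Data.List.Base using (applyUpTo)
open import Data.Nat.Base as ℕ using (ℕ; zero; suc)
open import Data.Product.Base using (_×_; _,_; ∃; ∃-syntax; proj₁; proj₂)
open import Data.Sum.Base using (_⊎_; inj₁; inj₂)
open import Level using (0ℓ)
open import Relation.Binary.Bundles using (StrictTotalOrder)
open import Relation.Binary.Core using (Rel)
open import Relation.Binary.Definitions using (tri<; tri≈; tri>)
open import Relation.Binary.Structures using (IsStrictTotalOrder)
open import Relation.Nullary using (¬_; contradiction)
open import Relation.Unary using (Pred; _∈_; Satisfiable)
import Algebra.Properties.Monoid.Mult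
import Algebra.Properties.Ring
import Data.List.Extrema
import Relation.Binary.Properties.StrictTotalOrder

-- Upper bounds and suprema with respect to the non-strict order
-- x < y ⊎ x ≈ y.
module Suprema {A : Set} (_≈_ _<_ : Rel A 0ℓ) where

  IsUpperBound : Pred A 0ℓ → A → Set
  IsUpperBound P u = ∀ x → x ∈ P → x < u ⊎ x ≈ u

  IsSupremum : Pred A 0ℓ → A → Set
  IsSupremum P s = IsUpperBound P s × (∀ u → IsUpperBound P u → s < u ⊎ s ≈ u)

-- The axioms characterising ℝ up to isomorphism.  In the presence of excluded
-- middle, which the theorem assumes, Dedekind cuts encoded as functions
-- ℚ → Bool provide an instance.
record CompleteOrderedField : Set₁ where
  field
    commutativeRing : CommutativeRing 0ℓ 0ℓ

  open CommutativeRing commutativeRing public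

  infix 4 _<_
  field
    _<_                : Rel Carrier 0ℓ
    isStrictTotalOrder : IsStrictTotalOrder _≈_ _<_
    0≉1                : ¬ (0# ≈ 1#)
    inverse            : ∀ x → ¬ (x ≈ 0#) → ∃[ y ] x * y ≈ 1#
    +-monoˡ-<          : ∀ z {x y} → x < y → x + z < y + z
    *-pos              : ∀ {x y} → 0# < x → 0# < y → 0# < x * y

  open Suprema _≈_ _<_ public

  field
    complete : ∀ (P : Pred Carrier 0ℓ) → Satisfiable P → ∃ (IsUpperBound P) →
               ∃ (IsSupremum P)

  strictTotalOrder : StrictTotalOrder 0ℓ 0ℓ 0ℓ
  strictTotalOrder = record { isStrictTotalOrder = isStrictTotalOrder }

  open StrictTotalOrder strictTotalOrder public
    using (compare; <-respˡ-≈; <-respʳ-≈)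
    renaming (irrefl to <-irrefl; trans to <-trans)

  open Relation.Binary.Properties.StrictTotalOrder strictTotalOrder public
    using (_≤_; totalOrder)
    renaming (trans to ≤-trans; refl to ≤-refl)

module Dispersion (ℝ : CompleteOrderedField) where

  open CompleteOrderedField ℝ
  -- n ⋆ x is the n-fold sum x + ⋯ + x.
  open Algebra.Properties.Monoid.Mult +-monoid using () renaming (_×_ to _⋆_)
  open Algebra.Properties.Ring ring
    using (-0#≈0#; -‿+-comm; -1*x≈-x; -‿involutive)
  open Data.List.Extrema totalOrder using (max)

  fromℤ : ℤ → Carrier
  fromℤ (ℤ.+ n)    = n ⋆ 1#
  fromℤ -[1+ n ] = - (suc n ⋆ 1#)

  IsInteger : Carrier → Set
  IsInteger x = ∃[ n ] x ≈ fromℤ n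

  -- Bounded intervals, possibly empty or degenerate.  Unbounded ones are
  -- irrelevant below: if I is unbounded then I + ℤ is all of ℝ.
  record Interval : Set where
    field
      lower upper              : Carrier
      lower≤upper              : lower ≤ upper
      leftClosed? rightClosed? : Bool

    length : Carrier
    length = upper - lower

    _∈ᴵ : Carrier → Set
    x ∈ᴵ = (if leftClosed?  then lower ≤ x else lower < x)
         × (if rightClosed? then x ≤ upper else x < upper)

  open Interval using (length)

  -- (I + ℤ) ∩ {0, θ, …, mθ} = ∅
  Avoids : Carrier → ℕ → Interval → Set
  Avoids θ m I = ∀ x (n : ℤ) k → Interval._∈ᴵ I x → k ℕ.≤ m →
                 ¬ (x + fromℤ n ≈ k ⋆ θ)

  GapLength : Carrier → ℕ → Pred Carrier 0ℓ
  GapLength θ m l = ∃[ I ] Avoids θ m I × l ≈ length I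

  ----------------------------------------------------------------------
  -- GapLength θ m is nonempty and bounded above by 1, so its supremum exists.

  private
    y-x+x≈y : ∀ x y → (y - x) + x ≈ y
    y-x+x≈y x y = trans (+-assoc y (- x) x)
      (trans (+-congˡ (-‿inverseˡ x)) (+-identityʳ y))

    y+x-x≈y : ∀ x y → (y + x) - x ≈ y
    y+x-x≈y x y = trans (+-assoc y x (- x))
      (trans (+-congˡ (-‿inverseʳ x)) (+-identityʳ y))

    +-monoˡ-≤ : ∀ z {x y} → x ≤ y → x + z ≤ y + z
    +-monoˡ-≤ z (inj₁ x<y) = inj₁ (+-monoˡ-< z x<y)
    +-monoˡ-≤ z (inj₂ x≈y) = inj₂ (+-congʳ x≈y)

    ≤-<-trans : ∀ {x y z} → x ≤ y → y < z → x < z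
    ≤-<-trans (inj₁ x<y) y<z = <-trans x<y y<z
    ≤-<-trans (inj₂ x≈y) y<z = <-respˡ-≈ (sym x≈y) y<z

    neg-antimono-< : ∀ {x y} → x < y → - y < - x
    neg-antimono-< {x} {y} x<y =
      <-respˡ-≈ (trans (sym (+-assoc x (- x) (- y)))
                       (trans (+-congʳ (-‿inverseʳ x)) (+-identityˡ (- y))))
      (<-respʳ-≈ (trans (+-congˡ (+-comm (- x) (- y)))
                 (trans (sym (+-assoc y (- y) (- x)))
                        (trans (+-congʳ (-‿inverseʳ y)) (+-identityˡ (- x)))))
                 (+-monoˡ-< (- x + - y) x<y))

    neg-antimono-≤ : ∀ {x y} → x ≤ y → - y ≤ - x
    neg-antimono-≤ (inj₁ x<y) = inj₁ (neg-antimono-< x<y)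
    neg-antimono-≤ (inj₂ x≈y) = inj₂ (-‿cong (sym x≈y))

    0<1 : 0# < 1#
    0<1 with compare 0# 1#
    ... | tri< p _ _ = p
    ... | tri≈ _ p _ = contradiction p 0≉1
    ... | tri> _ _ p = contradiction (<-trans 0<1′ p) (<-irrefl refl)
      where
      0<-1 : 0# < - 1#
      0<-1 = <-respˡ-≈ -0#≈0# (neg-antimono-< p)
      0<1′ : 0# < 1#
      0<1′ = <-respʳ-≈ (trans (-1*x≈-x (- 1#)) (-‿involutive 1#))
                       (*-pos 0<-1 0<-1)

    ℕ-unbounded : ∀ u → ¬ (∀ n → n ⋆ 1# ≤ u)
    ℕ-unbounded u bound = <-irrefl refl (≤-<-trans s≤s-1 s-1<s)
      where
      P : Pred Carrier 0ℓ
      P x = ∃[ n ] x ≈ n ⋆ 1#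
      sup : ∃ (IsSupremum P)
      sup = complete P (0# , 0 , refl)
                     (u , λ { x (n , x≈n) → ≤-trans (inj₂ x≈n) (bound n) })
      s = proj₁ sup
      s≤s-1 : s ≤ s - 1#
      s≤s-1 = proj₂ (proj₂ sup) (s - 1#) λ { x (n , x≈n) →
        ≤-trans (inj₂ (trans x≈n (sym (trans (+-congʳ (+-comm 1# (n ⋆ 1#)))
                                             (y+x-x≈y 1# (n ⋆ 1#))))))
                (+-monoˡ-≤ (- 1#) (proj₁ (proj₂ sup) _ (suc n , refl))) }
      s-1<s : s - 1# < s
      s-1<s = <-respʳ-≈ (y-x+x≈y 1# s)
        (<-respˡ-≈ (+-identityˡ (s - 1#))
          (<-respʳ-≈ (+-comm 1# (s - 1#)) (+-monoˡ-< (s - 1#) 0<1)))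

    fromℤ-neg : ∀ n → - (n ⋆ 1#) + fromℤ (ℤ.+ n) ≈ 0#
    fromℤ-neg n = -‿inverseˡ (n ⋆ 1#)

    fromℤ-pos : ∀ n → n ⋆ 1# + fromℤ (ℤ.- (ℤ.+ n)) ≈ 0#
    fromℤ-pos zero    = +-identityˡ 0#
    fromℤ-pos (suc n) = -‿inverseʳ (suc n ⋆ 1#)

    inside : ∀ I {x} → Interval.lower I < x → x < Interval.upper I →
             Interval._∈ᴵ I x
    inside I p q with Interval.leftClosed? I | Interval.rightClosed? I
    ... | true  | true  = inj₁ p , inj₁ q
    ... | true  | false = inj₁ p , q
    ... | false | true  = p , inj₁ q
    ... | false | false = p , q

  gapLength-nonempty : ∀ θ m → Satisfiable (GapLength θ m)
  gapLength-nonempty θ m = length ∅ᴵ , ∅ᴵ ,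
    (λ { x _ _ (0<x , x<0) _ _ → <-irrefl refl (<-trans 0<x x<0) }) , refl
    where
    ∅ᴵ : Interval
    ∅ᴵ = record { lower = 0# ; upper = 0# ; lower≤upper = ≤-refl
                ; leftClosed? = false ; rightClosed? = false }

  gapLength-bounded : ∀ θ m → IsUpperBound (GapLength θ m) 1#
  gapLength-bounded θ m l (I , avoids , l≈) with compare l 1#
  ... | tri< l<1 _ _ = inj₁ l<1
  ... | tri≈ _ l≈1 _ = inj₂ l≈1
  ... | tri> _ _ 1<l = contradiction a<0⊎ λ
        { (inj₁ a<0) → ℕ-unbounded (- b) (λ n →
            ≤-trans (inj₂ (sym (-‿involutive (n ⋆ 1#))))
                    (neg-antimono-≤ (below a<0 n)))
        ; (inj₂ 0≤a) → ℕ-unbounded a (above 0≤a) }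
    where
    a = Interval.lower I
    b = Interval.upper I

    1+a<b : 1# + a < b
    1+a<b = <-respʳ-≈ (y-x+x≈y a b) (+-monoˡ-< a (<-respʳ-≈ l≈ 1<l))

    noInt : ∀ {x} n → x + fromℤ n ≈ 0# → a < x → x < b → ⊥
    noInt n e p q = avoids _ n 0 (inside I p q) ℕ.z≤n e

    a<0⊎ : a < 0# ⊎ 0# ≤ a
    a<0⊎ with compare a 0#
    ... | tri< p _ _ = inj₁ p
    ... | tri≈ _ p _ = inj₂ (inj₂ (sym p))
    ... | tri> _ _ p = inj₂ (inj₁ p)

    above : 0# ≤ a → ∀ n → n ⋆ 1# ≤ a
    above 0≤a zero    = 0≤a
    above 0≤a (suc n) with compare (suc n ⋆ 1#) a
    ... | tri< p _ _ = inj₁ p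
    ... | tri≈ _ p _ = inj₂ p
    ... | tri> _ _ p = contradiction
          (≤-<-trans (≤-trans (inj₂ (+-comm 1# (n ⋆ 1#)))
                     (≤-trans (+-monoˡ-≤ 1# (above 0≤a n))
                              (inj₂ (+-comm a 1#)))) 1+a<b)
          (noInt (ℤ.- (ℤ.+ suc n)) (fromℤ-pos (suc n)) p)

    b≤ : ∀ {x} n → x + fromℤ n ≈ 0# → a < x → b ≤ x
    b≤ {x} n e a<x with compare b x
    ... | tri< p _ _ = inj₁ p
    ... | tri≈ _ p _ = inj₂ p
    ... | tri> _ _ p = contradiction p (noInt n e a<x)

    below : a < 0# → ∀ n → b ≤ - (n ⋆ 1#)
    below a<0 zero    = b≤ (ℤ.+ 0) (fromℤ-neg 0) (<-respʳ-≈ (sym -0#≈0#) a<0)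
    below a<0 (suc n) = b≤ (ℤ.+ suc n) (fromℤ-neg (suc n))
      (<-respˡ-≈ (trans (+-congʳ (+-comm 1# a)) (y+x-x≈y 1# a))
        (<-respʳ-≈ (trans (-‿+-comm (n ⋆ 1#) 1#)
                          (-‿cong (+-comm (n ⋆ 1#) 1#)))
          (+-monoˡ-< (- 1#) 1+a<-n)))
      where
      1+a<-n : 1# + a < - (n ⋆ 1#)
      1+a<-n with below a<0 n
      ... | inj₁ p = <-trans 1+a<b p
      ... | inj₂ p = <-respʳ-≈ p 1+a<b

  ----------------------------------------------------------------------

  d : Carrier → ℕ → Carrier
  d θ m = proj₁ (complete (GapLength θ m) (gapLength-nonempty θ m)
                          (1# , gapLength-bounded θ m))

  scaledGap : Carrier → ℕ → Carrier
  scaledGap θ m = suc m ⋆ d θ m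

  -- D(θ) = c; since D(θ) may be +∞, it is not a function into ℝ.
  D[_]≈_ : Carrier → Carrier → Set
  D[ θ ]≈ c = IsSupremum (λ x → ∃[ m ] 1 ℕ.≤ m × x ≈ scaledGap θ m) c

  -- max over 1 ≤ m ≤ M, for M ≥ 1; the first argument of max, its value on
  -- the empty list, is itself the m = 1 term.
  D[≤_] : ℕ → Carrier → Carrier
  D[≤ M ] θ = max (scaledGap θ 1) (applyUpTo (λ i → scaledGap θ (suc i)) M)

  IsPositiveSqrt : Carrier → Carrier → Set
  IsPositiveSqrt x r = 0# < r × r * r ≈ x

  -- Here r is √5 and t is 2/√5.
  𝒮 : Pred Carrier 0ℓ
  𝒮 θ = ∃[ r ] ∃[ t ] IsPositiveSqrt (5 ⋆ 1#) r × r * t ≈ 2 ⋆ 1# × D[ θ ]≈ (1# + t)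

{-# OPTIONS --safe #-}

-- Let x = |aθ - p| ≥ y = |bθ - p′| be the lengths of a Farey pair, so that a y + b x = 1.  A gap
-- of length x + y survives until the point with index a + b - 1 is placed, and a + b points leave
-- no gap longer than x; so D(θ) is the supremum of (a + b - 1)(x + y) over the pairs of θ.
--
-- With ψ = (√5 - 1)/2 the bound c = 1 + 2/√5 is (7 + 4ψ)/5.  If x ≥ 2y, then the next pair shows
-- x ≥ 2 - c.  Hence once x < 2 - c the Euclidean algorithm on (x , y) never subtracts twice, which
-- forces y = ψ x.  The pairs before that form a finite tree, whose branches are cut by linear
-- inequalities; only eight values of θ, up to sign and integers, survive.
--
-- For these, the values (a + b - 1)(x + y) eventually increase to c, with deficit about
-- (1 + ψ)x, while b + ψ a = 1/x.  The eight numbers b + ψ a are pairwise distinct modulo powers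
-- of ψ.  So just before θ₀ improves its value, every other θ has a strictly smaller deficit.

module Submission where

open import Defs
open import Algebra.Bundles using (RawRing)
import Algebra.Properties.Ring
import Algebra.Properties.Semiring.Mult
import Algebra.Solver.Ring
open import Algebra.Solver.Ring.AlmostCommutativeRing
  using (fromCommutativeRing; _-Raw-AlmostCommutative⟶_)
open import Axiom.ExcludedMiddle using (ExcludedMiddle)
open import Data.Bool.Base using (true; false; if_then_else_)
open import Data.Empty using (⊥; ⊥-elim)
open import Data.Integer.Base as ℤ using (ℤ; -[1+_]; +_; _⊖_)
import Data.Integer.Properties as ℤ
open import Data.Integer.Tactic.RingSolver using (solve-∀)
open import Data.List.Base using (List; []; _∷_; _++_; map; upTo)
import Data.List.Extrema
open import Data.List.Membership.Propositional.Properties using (∈-upTo⁺)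
open import Data.List.Relation.Unary.All as All using (All; []; _∷_; all?)
import Data.List.Relation.Unary.All.Properties as All
open import Data.List.Relation.Unary.Any as Any using (Any; any?; here; there)
import Data.List.Relation.Unary.Any.Properties as Any
open import Data.Maybe.Base using (Maybe; just; nothing)
open import Data.Nat.Base as ℕ using (ℕ; zero; suc)
import Data.Nat.Properties as ℕ
open import Data.Product.Base using (_×_; _,_; ∃; ∃-syntax; proj₁; proj₂; uncurry)
open import Data.Product.Properties using (≡-dec)
open import Data.Sum.Base using (_⊎_; inj₁; inj₂; [_,_])
open import Level using (0ℓ)
open import Relation.Binary.Bundles using (TotalOrder)
open import Relation.Binary.Definitions using (tri<; tri≈; tri>)
open import Relation.Binary.PropositionalEquality as ≡ using (_≡_)
import Relation.Binary.Reasoning.Setoid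
open import Relation.Nullary using (¬_; Dec; yes; no; does; contradiction)
open import Relation.Nullary.Decidable
  using (_×-dec_; _⊎-dec_; True; toWitness; map′; from-yes)
open import Relation.Unary using (_∈_)

-- Distinctness modulo powers of ψ suffices because the weights b + ψ a along each orbit of pairs
-- form a geometric progression of ratio 1 + ψ. Between two consecutive weights of θ₀ lies one
-- weight of every rival. The rival's pair there has a shorter length x = 1/weight, hence
-- asymptotically the smaller deficit, and its denominators are complete before the next pair of θ₀.
-- The corrections from b - (1 + ψ) a stay bounded while the differences grow geometrically, so the
-- comparison holds for all large levels at once.
--
-- The finite part has to be decided by evaluation, yet the order of ℝ does not compute. Integers
-- take its place: a y + b x = 1 makes every bound a homogeneous form in x and y, c is rounded up to
-- 3789/2000, and signs in ℤ[ψ] are certified at two Fibonacci quotients.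

-- Ordered fields: integers, sign certificates, the Archimedean property.

module OrderedField (ℝ : CompleteOrderedField) where
  open CompleteOrderedField ℝ
  open Dispersion ℝ
  open Algebra.Properties.Ring ring
    using (-0#≈0#; -‿+-comm; -‿involutive; -‿distribˡ-*; -‿distribʳ-*)
  open Algebra.Properties.Semiring.Mult semiring public
    renaming (_×_ to _⋆_) using (×-homo-+; ×1-homo-*; ×-congʳ; ×-assoc-*)
  open TotalOrder totalOrder public using () renaming (antisym to ≤-antisym)
  private module ≈-Reasoning = Relation.Binary.Reasoning.Setoid setoid
  open ≈-Reasoning

  fromℤ-⊖ : ∀ m n → fromℤ (m ⊖ n) ≈ m ⋆ 1# - n ⋆ 1#
  fromℤ-⊖ m zero = begin
    fromℤ (m ⊖ 0)   ≡⟨ ≡.cong fromℤ (ℤ.⊖-≥ {m} ℕ.z≤n) ⟩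
    m ⋆ 1#          ≈⟨ +-identityʳ _ ⟨
    m ⋆ 1# + 0#     ≈⟨ +-congˡ -0#≈0# ⟨
    m ⋆ 1# - 0#     ∎
  fromℤ-⊖ zero (suc n) = sym (+-identityˡ _)
  fromℤ-⊖ (suc m) (suc n) = begin
    fromℤ (suc m ⊖ suc n)              ≡⟨ ≡.cong fromℤ (ℤ.[1+m]⊖[1+n]≡m⊖n m n) ⟩
    fromℤ (m ⊖ n)                      ≈⟨ fromℤ-⊖ m n ⟩
    m ⋆ 1# - n ⋆ 1#                    ≈⟨ +-congʳ (+-identityˡ _) ⟨
    0# + m ⋆ 1# - n ⋆ 1#               ≈⟨ +-congʳ (+-congʳ (-‿inverseˡ 1#)) ⟨
    - 1# + 1# + m ⋆ 1# - n ⋆ 1#        ≈⟨ +-congʳ (+-assoc (- 1#) 1# _) ⟩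
    - 1# + (1# + m ⋆ 1#) - n ⋆ 1#      ≈⟨ +-congʳ (+-comm (- 1#) _) ⟩
    1# + m ⋆ 1# - 1# - n ⋆ 1#          ≈⟨ +-assoc _ (- 1#) _ ⟩
    1# + m ⋆ 1# + (- 1# - n ⋆ 1#)      ≈⟨ +-congˡ (-‿+-comm 1# _) ⟩
    1# + m ⋆ 1# - (1# + n ⋆ 1#)        ∎

  fromℤ-neg : ∀ i → fromℤ (ℤ.- i) ≈ - fromℤ i
  fromℤ-neg (ℤ.+ zero)  = sym -0#≈0#
  fromℤ-neg (ℤ.+ suc n) = refl
  fromℤ-neg -[1+ n ]    = sym (-‿involutive _)

  fromℤ-+ : ∀ i j → fromℤ (i ℤ.+ j) ≈ fromℤ i + fromℤ j
  fromℤ-+ (ℤ.+ m)  (ℤ.+ n)  = ×-homo-+ 1# m n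
  fromℤ-+ (ℤ.+ m)  -[1+ n ] = fromℤ-⊖ m (suc n)
  fromℤ-+ -[1+ m ] (ℤ.+ n)  = trans (fromℤ-⊖ n (suc m)) (+-comm _ _)
  fromℤ-+ -[1+ m ] -[1+ n ] = begin
    - (suc (suc (m ℕ.+ n)) ⋆ 1#)     ≡⟨ ≡.cong (λ k → - (suc k ⋆ 1#)) (ℕ.+-suc m n) ⟨
    - ((suc m ℕ.+ suc n) ⋆ 1#)       ≈⟨ -‿cong (×-homo-+ 1# (suc m) (suc n)) ⟩
    - (suc m ⋆ 1# + suc n ⋆ 1#)      ≈⟨ -‿+-comm _ _ ⟨
    - (suc m ⋆ 1#) - suc n ⋆ 1#      ∎

  private
    fromℤ-*ʳ : ∀ m j → fromℤ (ℤ.+ m ℤ.* j) ≈ m ⋆ 1# * fromℤ j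
    fromℤ-*ʳ m (ℤ.+ n) = begin
      fromℤ (ℤ.+ m ℤ.* ℤ.+ n)   ≡⟨ ≡.cong fromℤ (ℤ.pos-* m n) ⟨
      (m ℕ.* n) ⋆ 1#            ≈⟨ ×1-homo-* m n ⟩
      (m ⋆ 1#) * (n ⋆ 1#)       ∎
    fromℤ-*ʳ m -[1+ n ] = begin
      fromℤ (ℤ.+ m ℤ.* -[1+ n ])
        ≡⟨ ≡.cong fromℤ (ℤ.neg-distribʳ-* (ℤ.+ m) (ℤ.+ suc n)) ⟨
      fromℤ (ℤ.- (ℤ.+ m ℤ.* ℤ.+ suc n))   ≈⟨ fromℤ-neg (ℤ.+ m ℤ.* ℤ.+ suc n) ⟩
      - fromℤ (ℤ.+ m ℤ.* ℤ.+ suc n)       ≈⟨ -‿cong (fromℤ-*ʳ m (ℤ.+ suc n)) ⟩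
      - (m ⋆ 1# * (suc n ⋆ 1#))           ≈⟨ -‿distribʳ-* _ _ ⟩
      m ⋆ 1# * - (suc n ⋆ 1#)             ∎

  fromℤ-* : ∀ i j → fromℤ (i ℤ.* j) ≈ fromℤ i * fromℤ j
  fromℤ-* (ℤ.+ m)  j = fromℤ-*ʳ m j
  fromℤ-* -[1+ m ] j = begin
    fromℤ (-[1+ m ] ℤ.* j)
      ≡⟨ ≡.cong fromℤ (ℤ.neg-distribˡ-* (ℤ.+ suc m) j) ⟨
    fromℤ (ℤ.- (ℤ.+ suc m ℤ.* j))        ≈⟨ fromℤ-neg (ℤ.+ suc m ℤ.* j) ⟩
    - fromℤ (ℤ.+ suc m ℤ.* j)            ≈⟨ -‿cong (fromℤ-*ʳ (suc m) j) ⟩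
    - (suc m ⋆ 1# * fromℤ j)             ≈⟨ -‿distribˡ-* _ _ ⟩
    - (suc m ⋆ 1#) * fromℤ j             ∎

  fromℤ-homo : ℤ.+-*-rawRing -Raw-AlmostCommutative⟶ fromCommutativeRing commutativeRing
  fromℤ-homo = record
    { ⟦_⟧ = fromℤ ; +-homo = fromℤ-+ ; *-homo = fromℤ-* ; -‿homo = fromℤ-neg
    ; 0-homo = refl ; 1-homo = +-identityʳ 1# }

  fromℤ-≟ : ∀ i j → Maybe (fromℤ i ≈ fromℤ j)
  fromℤ-≟ i j with i ℤ.≟ j
  ... | yes ≡.refl = just refl
  ... | no _       = nothing

  module ℤ-Solver = Algebra.Solver.Ring ℤ.+-*-rawRing (fromCommutativeRing commutativeRing)
    fromℤ-homo fromℤ-≟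

  open ℤ-Solver

  infix 4 _≥0 _>0
  _≥0 _>0 : Carrier → Set
  x ≥0 = 0# ≤ x
  x >0 = 0# < x

  -- The pattern of most inequalities below: `e` is a certificate assembled from nonnegative terms
  -- with `_+₀_` and `_*₀_`, and the ring solver identifies it with the difference.
  ≤-by : ∀ {x y e} → e ≥0 → y - x ≈ e → x ≤ y
  ≤-by {x} {y} (inj₁ 0<e) eq = inj₁ (<-respˡ-≈ (+-identityˡ x)
    (<-respʳ-≈ (trans (+-congʳ (sym eq)) (solve 2 (λ x y → y :- x :+ x := y) refl x y))
      (+-monoˡ-< x 0<e)))
  ≤-by {x} {y} (inj₂ 0≈e) eq = inj₂ (trans (sym (+-identityˡ x))
    (trans (+-congʳ (trans 0≈e (sym eq))) (solve 2 (λ x y → y :- x :+ x := y) refl x y)))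

  <-by : ∀ {x y e} → e >0 → y - x ≈ e → x < y
  <-by {x} {y} 0<e eq = <-respˡ-≈ (+-identityˡ x)
    (<-respʳ-≈ (trans (+-congʳ (sym eq)) (solve 2 (λ x y → y :- x :+ x := y) refl x y))
      (+-monoˡ-< x 0<e))

  <⇒>0 : ∀ {x y} → x < y → y - x >0
  <⇒>0 {x} x<y = <-respˡ-≈ (-‿inverseʳ x) (+-monoˡ-< (- x) x<y)

  ≤⇒≥0 : ∀ {x y} → x ≤ y → y - x ≥0
  ≤⇒≥0 (inj₁ x<y) = inj₁ (<⇒>0 x<y)
  ≤⇒≥0 {x} (inj₂ x≈y) = inj₂ (trans (sym (-‿inverseʳ x)) (+-congʳ x≈y))

  ≥0-resp : ∀ {x y} → x ≈ y → x ≥0 → y ≥0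
  ≥0-resp x≈y (inj₁ p) = inj₁ (<-respʳ-≈ x≈y p)
  ≥0-resp x≈y (inj₂ p) = inj₂ (trans p x≈y)

  ≤-resp : ∀ {x x′ y y′} → x ≈ x′ → y ≈ y′ → x ≤ y → x′ ≤ y′
  ≤-resp p q (inj₁ r) = inj₁ (<-respˡ-≈ p (<-respʳ-≈ q r))
  ≤-resp p q (inj₂ r) = inj₂ (trans (sym p) (trans r q))

  <-≤-trans : ∀ {x y z} → x < y → y ≤ z → x < z
  <-≤-trans p (inj₁ q) = <-trans p q
  <-≤-trans p (inj₂ q) = <-respʳ-≈ q p

  ≤-<-trans : ∀ {x y z} → x ≤ y → y < z → x < z
  ≤-<-trans (inj₁ p) q = <-trans p q
  ≤-<-trans (inj₂ p) q = <-respˡ-≈ (sym p) q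

  infixl 6 _+₊_ _+₀_
  infixl 7 _*₊_ _*₀_
  _+₊_ : ∀ {x y} → x >0 → y ≥0 → x + y >0
  _+₊_ {x} {y} p (inj₁ q) = <-trans p (<-respˡ-≈ (+-identityˡ x)
    (<-respʳ-≈ (+-comm y x) (+-monoˡ-< x q)))
  _+₊_ {x} {y} p (inj₂ q) = <-respʳ-≈ (trans (sym (+-identityʳ x)) (+-congˡ q)) p

  _+₀_ : ∀ {x y} → x ≥0 → y ≥0 → x + y ≥0
  inj₁ p +₀ q = inj₁ (p +₊ q)
  _+₀_ {x} {y} (inj₂ p) q = ≥0-resp (trans (sym (+-identityˡ y)) (+-congʳ p)) q

  _*₊_ : ∀ {x y} → x >0 → y >0 → x * y >0
  _*₊_ = *-pos

  _*₀_ : ∀ {x y} → x ≥0 → y ≥0 → x * y ≥0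
  inj₁ p *₀ inj₁ q = inj₁ (p *₊ q)
  _*₀_ {x} {y} (inj₁ p) (inj₂ q) = inj₂ (trans (sym (zeroʳ x)) (*-congˡ q))
  _*₀_ {x} {y} (inj₂ p) q = inj₂ (trans (sym (zeroˡ y)) (*-congʳ p))

  >0⇒≉0 : ∀ {x} → x >0 → ¬ (x ≈ 0#)
  >0⇒≉0 p eq = <-irrefl (sym eq) p

  <⇒≱ : ∀ {x y} → x < y → ¬ (y ≤ x)
  <⇒≱ p q = <-irrefl refl (<-≤-trans p q)

  ≤∨> : ∀ x y → x ≤ y ⊎ y < x
  ≤∨> x y with compare x y
  ... | tri< p _ _ = inj₁ (inj₁ p)
  ... | tri≈ _ p _ = inj₁ (inj₂ p)
  ... | tri> _ _ p = inj₂ p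

  ≮⇒≥ : ∀ {x y} → ¬ (x < y) → y ≤ x
  ≮⇒≥ {x} {y} ¬p with ≤∨> y x
  ... | inj₁ p = p
  ... | inj₂ p = contradiction p ¬p

  *-cancelˡ-≤ : ∀ {x y z} → x >0 → x * y ≤ x * z → y ≤ z
  *-cancelˡ-≤ {x} {y} {z} x>0 p = ≮⇒≥ λ z<y → <⇒≱ (<-by (x>0 *₊ <⇒>0 z<y)
    (solve 3 (λ x y z → x :* y :- x :* z := x :* (y :- z)) refl x y z)) p

  *-cancelˡ-< : ∀ {x y z} → x >0 → x * y < x * z → y < z
  *-cancelˡ-< {x} {y} {z} x>0 p with ≤∨> z y
  ... | inj₂ q = q
  ... | inj₁ q = contradiction (≤-by (inj₁ x>0 *₀ ≤⇒≥0 q)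
    (solve 3 (λ x y z → x :* y :- x :* z := x :* (y :- z)) refl x y z)) (<⇒≱ p)

  1>0 : 1# >0
  1>0 with compare 0# 1#
  ... | tri< p _ _ = p
  ... | tri≈ _ p _ = contradiction p 0≉1
  ... | tri> _ _ p = contradiction (<-trans p 0<1) (<-irrefl refl)
    where
    -1>0 : - 1# >0
    -1>0 = <-respʳ-≈ (+-identityˡ _) (<⇒>0 p)
    0<1 : 1# >0
    0<1 = <-respʳ-≈ (*-identityˡ 1#)
      (<-respʳ-≈ (solve 1 (λ x → :- x :* :- x := x :* x) refl 1#) (-1>0 *₊ -1>0))

  n≥0 : ∀ n → n ⋆ 1# ≥0
  n≥0 zero    = ≤-refl
  n≥0 (suc n) = inj₁ (1>0 +₊ n≥0 n)

  1+n>0 : ∀ n → suc n ⋆ 1# >0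
  1+n>0 n = 1>0 +₊ n≥0 n

  ⋆-mono : ∀ {m n} → m ℕ.≤ n → m ⋆ 1# ≤ n ⋆ 1#
  ⋆-mono {m} m≤n with k , ≡.refl ← ℕ.m≤n⇒∃[o]m+o≡n m≤n =
    ≤-by (n≥0 k) (trans (+-congʳ (×-homo-+ 1# m k))
      (solve 2 (λ x y → x :+ y :- x := y) refl _ _))

  ⋆-cancel-< : ∀ {m n} → m ⋆ 1# < n ⋆ 1# → m ℕ.< n
  ⋆-cancel-< {m} {n} p with n ℕ.≤? m
  ... | yes n≤m = contradiction (⋆-mono n≤m) (<⇒≱ p)
  ... | no n≰m  = ℕ.≰⇒> n≰m

  fromℤ-nonPos∨≥1 : ∀ i → fromℤ i ≤ 0# ⊎ fromℤ ℤ.1ℤ ≤ fromℤ i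
  fromℤ-nonPos∨≥1 (ℤ.+ zero)  = inj₁ ≤-refl
  fromℤ-nonPos∨≥1 (ℤ.+ suc n) = inj₂ (⋆-mono {1} {suc n} (ℕ.s≤s ℕ.z≤n))
  fromℤ-nonPos∨≥1 -[1+ n ]    =
    inj₁ (inj₁ (<-by (1+n>0 n) (trans (+-identityˡ _) (-‿involutive _))))

  ⋆-as-* : ∀ n x → n ⋆ x ≈ (n ⋆ 1#) * x
  ⋆-as-* n x = sym (trans (×-assoc-* n 1# x) (×-congʳ n (*-identityˡ x)))

  record GoldenNumber : Set where
    field
      ψ      : Carrier
      ψ>0    : ψ >0
      ψ²≈1-ψ : ψ * ψ ≈ 1# - ψ

  -- c = 1 + 2/√5.
  record CriticalValue (G : GoldenNumber) : Set where
    open GoldenNumber G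
    field
      c       : Carrier
      5c≈7+4ψ : 5 ⋆ 1# * c ≈ 7 ⋆ 1# + 4 ⋆ 1# * ψ

  module _ (em : ExcludedMiddle 0ℓ) where

    archimedean : ∀ x → ∃[ n ] x < n ⋆ 1#
    archimedean x with em {P = ∃[ n ] x < n ⋆ 1#}
    ... | yes p = p
    ... | no ¬p = contradiction
      (<-≤-trans (<-by 1>0 (solve 2 (λ s x → s :- (s :- x) := x) refl s 1#)) s≤s-1) (<-irrefl refl)
      where
      bounded : ∀ n → n ⋆ 1# ≤ x
      bounded n = ≮⇒≥ λ q → ¬p (n , q)
      sup : ∃ (IsSupremum (λ y → ∃[ n ] y ≈ n ⋆ 1#))
      sup = complete _ (0# , 0 , refl)
        (x , λ { y (n , y≈n) → ≤-resp (sym y≈n) refl (bounded n) })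
      s = proj₁ sup
      s≤s-1 : s ≤ s - 1#
      s≤s-1 = proj₂ (proj₂ sup) (s - 1#) λ { y (n , y≈n) →
        ≤-by (≤⇒≥0 (proj₁ (proj₂ sup) _ (suc n , refl)))
          (trans (+-congˡ (-‿cong y≈n))
            (solve 3 (λ s x n → s :- x :- n := s :- (x :+ n)) refl s 1# (n ⋆ 1#))) }

    archimedean-* : ∀ x {δ} → δ >0 → ∃[ n ] x < (n ⋆ 1#) * δ
    archimedean-* x {δ} 0<δ with inverse δ (>0⇒≉0 0<δ)
    ... | δ⁻¹ , eq with archimedean (x * δ⁻¹)
    ... | n , p = n , <-by (<⇒>0 p *₊ 0<δ)
      (trans (+-congˡ (-‿cong (trans (sym (*-identityʳ x)) (*-congˡ (sym eq)))))
        (solve 4 (λ n d x e → n :* d :- x :* (d :* e) := (n :- x :* e) :* d) refl _ _ _ _))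

-- Farey pairs and the gaps that they control.

module FareyPairs (ℝ : CompleteOrderedField) where
  open CompleteOrderedField ℝ
  open Dispersion ℝ
  open OrderedField ℝ
  open ℤ-Solver

  -- With x, y ≥ 0 and positive denominators, θ lies between the Farey neighbours p / a and p′ / b.
  -- Signs are left to the lemmas, so one length can be subtracted from the other before they are
  -- compared.
  record FareyPair (θ : Carrier) (a : ℕ) (x : Carrier) (b : ℕ) (y : Carrier) : Set where
    constructor fareyPair
    field
      p p′       : ℤ
      x≈         : x ≈ a ⋆ 1# * θ - fromℤ p
      y≈         : y ≈ fromℤ p′ - b ⋆ 1# * θ
      unimodular : ℤ.+ a ℤ.* p′ ℤ.- p ℤ.* ℤ.+ b ≡ ℤ.1ℤ

    determinant : a ⋆ 1# * fromℤ p′ - fromℤ p * b ⋆ 1# ≈ 1#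
    determinant = trans (sym (trans (fromℤ-+ (ℤ.+ a ℤ.* p′) (ℤ.- (p ℤ.* ℤ.+ b)))
        (+-cong (fromℤ-* (ℤ.+ a) p′) (trans (fromℤ-neg (p ℤ.* ℤ.+ b)) (-‿cong (fromℤ-* p (ℤ.+ b)))))))
      (trans (reflexive (≡.cong fromℤ unimodular)) (+-identityʳ 1#))

  d-upper : ∀ θ m l → GapLength θ m l → l ≤ d θ m
  d-upper θ m = proj₁ (proj₂ (complete (GapLength θ m) (gapLength-nonempty θ m)
                                       (1# , gapLength-bounded θ m)))

  d-least : ∀ θ m u → IsUpperBound (GapLength θ m) u → d θ m ≤ u
  d-least θ m = proj₂ (proj₂ (complete (GapLength θ m) (gapLength-nonempty θ m)
                                       (1# , gapLength-bounded θ m)))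

  -- The point with index a + b - 1 sits at distance x from its left neighbour and y
  -- from its right one, so before it is inserted there is a gap of length x + y.
  -- A point at offset δ from it with index difference w has (w , δ) = u (a , x) + v (b , -y).
  gap-lower : ∀ {θ a x b y m} → FareyPair θ a x b y → x ≥0 → y ≥0 →
              2 ℕ.+ m ℕ.≤ a ℕ.+ b → x + y ≤ d θ m
  gap-lower {θ} {a} {x} {b} {y} {m} F x≥0 y≥0 m+2≤a+b
    with o , m+2+o≡a+b ← ℕ.m≤n⇒∃[o]m+o≡n m+2≤a+b =
    d-upper θ m (x + y) (I , avoids ,
      solve 3 (λ x y J → x :+ y := (J :+ y) :- (J :- x)) refl x y J)
    where
    open FareyPair F
    j = suc (m ℕ.+ o)
    J = j ⋆ 1# * θ
    A = a ⋆ 1#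
    B = b ⋆ 1#
    I : Interval
    I = record
      { lower = J - x ; upper = J + y
      ; lower≤upper = ≤-by (x≥0 +₀ y≥0)
          (solve 3 (λ x y J → (J :+ y) :- (J :- x) := x :+ y) refl x y J)
      ; leftClosed? = false ; rightClosed? = false }

    1+j≈a+b : 1# + j ⋆ 1# ≈ A + B
    1+j≈a+b = trans (reflexive (≡.cong (_⋆ 1#) m+2+o≡a+b)) (×-homo-+ 1# a b)

    avoids : Avoids θ m I
    avoids z n k (J-x<z , z<J+y) k≤m z+n≈kθ =
      case-uv (fromℤ-nonPos∨≥1 u) (fromℤ-nonPos∨≥1 v)
      where
      w = ℤ.+ j ℤ.- ℤ.+ k
      -- Cramer's rule for (w , - n) = u (a , p) + v (b , p′); determinant 1 keeps u and v integral.
      u = w ℤ.* p′ ℤ.+ n ℤ.* ℤ.+ b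
      v = ℤ.- (n ℤ.* ℤ.+ a) ℤ.- w ℤ.* p
      W = j ⋆ 1# - k ⋆ 1#
      U = fromℤ u
      V = fromℤ v
      N = fromℤ n
      P = fromℤ p
      P′ = fromℤ p′

      W≈ : fromℤ w ≈ W
      W≈ = trans (fromℤ-+ (ℤ.+ j) (ℤ.- ℤ.+ k)) (+-congˡ (fromℤ-neg (ℤ.+ k)))

      U≈ : U ≈ W * P′ + N * B
      U≈ = trans (fromℤ-+ (w ℤ.* p′) (n ℤ.* ℤ.+ b))
        (+-cong (trans (fromℤ-* w p′) (*-congʳ W≈)) (fromℤ-* n (ℤ.+ b)))

      V≈ : V ≈ - (N * A) - W * P
      V≈ = trans (fromℤ-+ (ℤ.- (n ℤ.* ℤ.+ a)) (ℤ.- (w ℤ.* p)))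
        (+-cong (trans (fromℤ-neg (n ℤ.* ℤ.+ a)) (-‿cong (fromℤ-* n (ℤ.+ a))))
                (trans (fromℤ-neg (w ℤ.* p)) (-‿cong (trans (fromℤ-* w p) (*-congʳ W≈)))))

      W-expansion : U * A + V * B ≈ W
      W-expansion = trans (+-cong (*-congʳ U≈) (*-congʳ V≈))
        (trans (solve 6 (λ W N A B P P′ →
            (W :* P′ :+ N :* B) :* A :+ (:- (N :* A) :- W :* P) :* B := W :* (A :* P′ :- P :* B))
            refl W N A B P P′)
          (trans (*-congˡ determinant) (*-identityʳ W)))

      δ-expansion : U * x - V * y ≈ J - z
      δ-expansion = trans (+-cong (*-cong U≈ x≈) (-‿cong (*-cong V≈ y≈)))
        (trans (solve 7 (λ W N A B P P′ t →
            (W :* P′ :+ N :* B) :* (A :* t :- P) :- (:- (N :* A) :- W :* P) :* (P′ :- B :* t)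
            := (W :* t :+ N) :* (A :* P′ :- P :* B)) refl W N A B P P′ θ)
          (trans (*-congˡ determinant) (trans (*-identityʳ _)
            (trans (solve 5 (λ j k t N z → (j :- k) :* t :+ N := j :* t :- z :+ (z :+ N :- k :* t))
                refl (j ⋆ 1#) (k ⋆ 1#) θ N z)
              (trans (+-congˡ (trans (+-congʳ (trans z+n≈kθ (⋆-as-* k θ))) (-‿inverseʳ _)))
                (+-identityʳ _))))))

      W>0 : W >0
      W>0 = <-respʳ-≈
        (solve 3 (λ i j k → i :+ (j :- k) := i :+ j :- k) refl 1# ((m ℕ.+ o) ⋆ 1#) (k ⋆ 1#))
        (1>0 +₊ ≤⇒≥0 (⋆-mono (ℕ.≤-trans k≤m (ℕ.m≤m+n m o))))

      W<A+B : W < A + B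
      W<A+B = <-by (1>0 +₊ n≥0 k) (trans (+-congʳ (sym 1+j≈a+b))
        (solve 3 (λ i j k → i :+ j :- (j :- k) := i :+ k) refl 1# (j ⋆ 1#) (k ⋆ 1#)))

      -- Coefficients both ≤ 0 or both ≥ 1 contradict 0 < W < A + B. In the mixed cases J - z is at
      -- least x or at most - y, which puts z outside the interval.
      case-uv : U ≤ 0# ⊎ fromℤ ℤ.1ℤ ≤ U → V ≤ 0# ⊎ fromℤ ℤ.1ℤ ≤ V → ⊥
      case-uv (inj₁ U≤0) (inj₁ V≤0) = <⇒≱ W>0
        (≤-by (≤⇒≥0 U≤0 *₀ n≥0 a +₀ ≤⇒≥0 V≤0 *₀ n≥0 b)
          (trans (+-congˡ (-‿cong (sym W-expansion)))
            (solve 4 (λ U V A B → con ℤ.0ℤ :- (U :* A :+ V :* B) :=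
              (con ℤ.0ℤ :- U) :* A :+ (con ℤ.0ℤ :- V) :* B) refl U V A B)))
      case-uv (inj₂ U≥1) (inj₂ V≥1) = <⇒≱ W<A+B
        (≤-by (≤⇒≥0 U≥1 *₀ n≥0 a +₀ ≤⇒≥0 V≥1 *₀ n≥0 b)
          (trans (+-congʳ (sym W-expansion))
            (solve 4 (λ U V A B → U :* A :+ V :* B :- (A :+ B) :=
              (U :- con ℤ.1ℤ) :* A :+ (V :- con ℤ.1ℤ) :* B) refl U V A B)))
      case-uv (inj₂ U≥1) (inj₁ V≤0) = <⇒≱ J-x<z
        (≤-by (≤⇒≥0 U≥1 *₀ x≥0 +₀ ≤⇒≥0 V≤0 *₀ y≥0)
          (trans (solve 3 (λ J x z → J :- x :- z := J :- z :- x) refl J x z)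
          (trans (+-congʳ (sym δ-expansion))
            (solve 4 (λ U V x y → U :* x :- V :* y :- x :=
              (U :- con ℤ.1ℤ) :* x :+ (con ℤ.0ℤ :- V) :* y) refl U V x y))))
      case-uv (inj₁ U≤0) (inj₂ V≥1) = <⇒≱ z<J+y
        (≤-by (≤⇒≥0 U≤0 *₀ x≥0 +₀ ≤⇒≥0 V≥1 *₀ y≥0)
          (trans (solve 3 (λ J y z → z :- (J :+ y) := :- (J :- z) :- y) refl J y z)
          (trans (+-congʳ (-‿cong (sym δ-expansion)))
            (solve 4 (λ U V x y → :- (U :* x :- V :* y) :- y :=
              (con ℤ.0ℤ :- U) :* x :+ (V :- con ℤ.1ℤ) :* y) refl U V x y))))

  inside : ∀ I {x} → Interval.lower I < x → x < Interval.upper I → Interval._∈ᴵ I x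
  inside I p q with Interval.leftClosed? I | Interval.rightClosed? I
  ... | true  | true  = inj₁ p , inj₁ q
  ... | true  | false = inj₁ p , q
  ... | false | true  = p , inj₁ q
  ... | false | false = p , q

  -- Among the points with index below a + b, each has another one at distance x or y to
  -- its right, namely k + a if k < b and k - b otherwise.
  gap-upper : ExcludedMiddle 0ℓ → ∀ {θ a x b y m s} → FareyPair θ a x b y → x >0 → y >0 →
              x ≤ s → y ≤ s → 0 ℕ.< a ℕ.+ b → a ℕ.+ b ℕ.≤ suc m → d θ m ≤ s
  gap-upper em {θ} {a} {x} {b} {y} {m} {s} F x>0 y>0 x≤s y≤s 0<a+b a+b≤1+m =
    d-least θ m s λ { l (I , avoids , l≈) → ≤-resp (sym l≈) refl (≮⇒≥ (too-long I avoids)) }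
    where
    open FareyPair F

    position : ℕ → ℤ → Carrier
    position k n = k ⋆ 1# * θ - fromℤ n

    min : ∃[ δ ] δ >0 × δ ≤ x × δ ≤ y
    min with ≤∨> x y
    ... | inj₁ x≤y = x , x>0 , ≤-refl , x≤y
    ... | inj₂ y<x = y , y>0 , inj₁ y<x , ≤-refl
    δ = proj₁ min
    δ>0 = proj₁ (proj₂ min)

    step : ∀ k n → k ℕ.< a ℕ.+ b → ∃[ k′ ] ∃[ n′ ] ∃[ e ]
           k′ ℕ.< a ℕ.+ b × position k′ n′ ≈ position k n + e × δ ≤ e × e ≤ s
    step k n k<a+b with k ℕ.<? b
    ... | yes k<b = a ℕ.+ k , n ℤ.+ p , x , ℕ.+-monoʳ-< a k<b ,
          trans (+-cong (*-congʳ (×-homo-+ 1# a k)) (-‿cong (fromℤ-+ n p)))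
            (trans (solve 5 (λ A K t N P → (A :+ K) :* t :- (N :+ P) := K :* t :- N :+ (A :* t :- P))
                refl _ _ _ _ _)
              (+-congˡ (sym x≈))) ,
          proj₁ (proj₂ (proj₂ min)) , x≤s
    ... | no k≮b with o , ≡.refl ← ℕ.m≤n⇒∃[o]m+o≡n (ℕ.≮⇒≥ k≮b) =
          o , n ℤ.- p′ , y , ℕ.≤-<-trans (ℕ.m≤n+m o b) k<a+b ,
          trans (+-congˡ (-‿cong (trans (fromℤ-+ n (ℤ.- p′)) (+-congˡ (fromℤ-neg p′)))))
            (trans (solve 5 (λ B O t N P → O :* t :- (N :- P) := (B :+ O) :* t :- N :+ (P :- B :* t))
                refl (b ⋆ 1#) _ _ _ _)
              (+-cong (+-congʳ (*-congʳ (sym (×-homo-+ 1# b o)))) (sym y≈))) ,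
          proj₂ (proj₂ (proj₂ min)) , y≤s

    -- `t` is fuel: every step moves right by at least `δ`, so the walk passes `l`. The first point
    -- beyond `l` overshoots it by at most one step, hence by at most `s`.
    walk : ∀ l t k n → k ℕ.< a ℕ.+ b → position k n ≤ l → l < position k n + t ⋆ 1# * δ →
           ∃[ k′ ] ∃[ n′ ] k′ ℕ.< a ℕ.+ b × l < position k′ n′ × position k′ n′ ≤ l + s
    walk l zero k n _ pos≤l l<pos = contradiction pos≤l
      (<⇒≱ (<-respʳ-≈ (trans (+-congˡ (zeroˡ δ)) (+-identityʳ _)) l<pos))
    walk l (suc t) k n k<a+b pos≤l l<pos with step k n k<a+b
    ... | k′ , n′ , e , k′<a+b , pos′≈ , δ≤e , e≤s with ≤∨> (position k′ n′) l
    ... | inj₂ l<pos′ = k′ , n′ , k′<a+b , l<pos′ ,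
          ≤-by (≤⇒≥0 pos≤l +₀ ≤⇒≥0 e≤s) (trans (+-congˡ (-‿cong pos′≈))
            (solve 4 (λ l s q e → l :+ s :- (q :+ e) := l :- q :+ (s :- e)) refl _ _ _ _))
    ... | inj₁ pos′≤l = walk l t k′ n′ k′<a+b pos′≤l
          (<-by (<⇒>0 l<pos +₊ ≤⇒≥0 δ≤e) (trans (+-congʳ (+-congʳ pos′≈))
            (trans (solve 5 (λ q e t δ l → q :+ e :+ t :* δ :- l :=
                q :+ (δ :+ t :* δ) :- l :+ (e :- δ)) refl _ _ _ _ _)
              (+-congʳ (+-congʳ (+-congˡ (trans (+-congʳ (sym (*-identityˡ δ)))
                (sym (distribʳ δ 1# (t ⋆ 1#))))))))))

    too-long : ∀ I → Avoids θ m I → ¬ (s < Interval.length I)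
    too-long I avoids s<length =
      let (n , -l<n)     = archimedean em (- l)
          (t , l-pos<tδ) = archimedean-* em (l - position 0 (ℤ.+ n)) δ>0
          (k , n′ , k<a+b , l<pos , pos≤l+s) = walk l t 0 (ℤ.+ n) 0<a+b
            (inj₁ (<-by (<⇒>0 -l<n)
              (solve 3 (λ l t n → l :- (con ℤ.0ℤ :* t :- n) := n :- :- l) refl l θ (n ⋆ 1#))))
            (<-by (<⇒>0 l-pos<tδ) (solve 3 (λ l q r → q :+ r :- l := r :- (l :- q)) refl
              l (position 0 (ℤ.+ n)) (t ⋆ 1# * δ)))
      in avoids (position k n′) n′ k
        (inside I l<pos (≤-<-trans pos≤l+s (<-by (<⇒>0 s<length)
          (solve 3 (λ u l s → u :- (l :+ s) := u :- l :- s) refl (Interval.upper I) l s))))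
        (ℕ.s≤s⁻¹ (ℕ.≤-trans k<a+b a+b≤1+m))
        (trans (solve 2 (λ q n → q :- n :+ n := q) refl (k ⋆ 1# * θ) (fromℤ n′)) (sym (⋆-as-* k θ)))
      where l = Interval.lower I

  -- Exchanging the two sides amounts to replacing θ by -θ.
  FareyPair± : Carrier → ℕ → Carrier → ℕ → Carrier → Set
  FareyPair± θ a x b y = FareyPair θ a x b y ⊎ FareyPair θ b y a x

  swap : ∀ {θ a x b y} → FareyPair± θ a x b y → FareyPair± θ b y a x
  swap (inj₁ F) = inj₂ F
  swap (inj₂ F) = inj₁ F

  FareyPair-resp : ∀ {θ a x x′ b y y′} → x ≈ x′ → y ≈ y′ →
                   FareyPair θ a x b y → FareyPair θ a x′ b y′
  FareyPair-resp x≈x′ y≈y′ (fareyPair p p′ x≈ y≈ unimodular) =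
    fareyPair p p′ (trans (sym x≈x′) x≈) (trans (sym y≈y′) y≈) unimodular

  FareyPair±-resp : ∀ {θ a x x′ b y y′} → x ≈ x′ → y ≈ y′ →
                    FareyPair± θ a x b y → FareyPair± θ a x′ b y′
  FareyPair±-resp p q (inj₁ F) = inj₁ (FareyPair-resp p q F)
  FareyPair±-resp p q (inj₂ F) = inj₂ (FareyPair-resp q p F)

  private
    step-x : ∀ {θ a x b y} → FareyPair θ a x b y → FareyPair θ (a ℕ.+ b) (x - y) b y
    step-x {θ} {a} {x} {b} {y} (fareyPair p p′ x≈ y≈ unimodular) = fareyPair (p ℤ.+ p′) p′
      (trans (+-cong x≈ (-‿cong y≈))
        (trans (solve 5 (λ A B t P P′ → (A :* t :- P) :- (P′ :- B :* t) := (A :+ B) :* t :- (P :+ P′))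
            refl _ _ _ _ _)
          (sym (+-cong (*-congʳ (×-homo-+ 1# a b)) (-‿cong (fromℤ-+ p p′))))))
      y≈ (≡.trans (identity (ℤ.+ a) (ℤ.+ b) p p′) unimodular)
      where
      identity : ∀ a b p p′ → (a ℤ.+ b) ℤ.* p′ ℤ.- (p ℤ.+ p′) ℤ.* b ≡ a ℤ.* p′ ℤ.- p ℤ.* b
      identity = solve-∀

    step-y : ∀ {θ a x b y} → FareyPair θ a x b y → FareyPair θ a x (b ℕ.+ a) (y - x)
    step-y {θ} {a} {x} {b} {y} (fareyPair p p′ x≈ y≈ unimodular) = fareyPair p (p ℤ.+ p′)
      x≈
      (trans (+-cong y≈ (-‿cong x≈))
        (trans (solve 5 (λ A B t P P′ → (P′ :- B :* t) :- (A :* t :- P) := (P :+ P′) :- (B :+ A) :* t)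
            refl _ _ _ _ _)
          (sym (+-cong (fromℤ-+ p p′) (-‿cong (*-congʳ (×-homo-+ 1# b a)))))))
      (≡.trans (identity (ℤ.+ a) (ℤ.+ b) p p′) unimodular)
      where
      identity : ∀ a b p p′ → a ℤ.* (p ℤ.+ p′) ℤ.- p ℤ.* (b ℤ.+ a) ≡ a ℤ.* p′ ℤ.- p ℤ.* b
      identity = solve-∀

  -- One subtraction of the Euclidean algorithm, that is, insertion of the mediant (p + p′) / (a +
  -- b).
  step : ∀ {θ a x b y} → FareyPair± θ a x b y → FareyPair± θ (a ℕ.+ b) (x - y) b y
  step (inj₁ F) = inj₁ (step-x F)
  step (inj₂ F) = inj₂ (step-y F)

  -- Unimodularity with θ eliminated; later it replaces the constant 1 wherever a bound is made
  -- homogeneous in x and y.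
  determinant± : ∀ {θ a x b y} → FareyPair± θ a x b y → a ⋆ 1# * y + b ⋆ 1# * x ≈ 1#
  determinant± (inj₁ F) = det F
    where
    det : ∀ {θ a x b y} → FareyPair θ a x b y → a ⋆ 1# * y + b ⋆ 1# * x ≈ 1#
    det F@(fareyPair p p′ x≈ y≈ _) = trans (+-cong (*-congˡ y≈) (*-congˡ x≈))
      (trans (solve 5 (λ A B t P P′ → A :* (P′ :- B :* t) :+ B :* (A :* t :- P) := A :* P′ :- P :* B)
          refl _ _ _ _ _)
        (FareyPair.determinant F))
  determinant± (inj₂ F) = trans (+-comm _ _) (determinant± (inj₁ F))

  gap-lower± : ∀ {θ a x b y m} → FareyPair± θ a x b y → x ≥0 → y ≥0 →
               2 ℕ.+ m ℕ.≤ a ℕ.+ b → x + y ≤ d θ m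
  gap-lower± (inj₁ F) x≥0 y≥0 h = gap-lower F x≥0 y≥0 h
  gap-lower± {a = a} {b = b} {m = m} (inj₂ F) x≥0 y≥0 h = ≤-resp (+-comm _ _) refl
    (gap-lower F y≥0 x≥0 (≡.subst (2 ℕ.+ m ℕ.≤_) (ℕ.+-comm a b) h))

  gap-upper± : ExcludedMiddle 0ℓ → ∀ {θ a x b y m s} → FareyPair± θ a x b y → x >0 → y >0 →
               x ≤ s → y ≤ s → 0 ℕ.< a ℕ.+ b → a ℕ.+ b ℕ.≤ suc m → d θ m ≤ s
  gap-upper± em (inj₁ F) = gap-upper em F
  gap-upper± em {a = a} {b = b} {m = m} (inj₂ F) x>0 y>0 x≤s y≤s h h′ =
    gap-upper em F y>0 x>0 y≤s x≤s
      (≡.subst (0 ℕ.<_) (ℕ.+-comm a b) h) (≡.subst (ℕ._≤ suc m) (ℕ.+-comm a b) h′)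

-- The ring ℤ[ψ] and certified signs.

-- (m , n) stands for m + n ψ, where ψ² = 1 - ψ.
ℤ[ψ] : RawRing 0ℓ 0ℓ
ℤ[ψ] = record
  { Carrier = ℤ × ℤ
  ; _≈_ = _≡_
  ; _+_ = λ (m , n) (m′ , n′) → m ℤ.+ m′ , n ℤ.+ n′
  ; _*_ = λ (m , n) (m′ , n′) →
      m ℤ.* m′ ℤ.+ n ℤ.* n′ , m ℤ.* n′ ℤ.+ n ℤ.* m′ ℤ.- n ℤ.* n′
  ; -_ = λ (m , n) → ℤ.- m , ℤ.- n
  ; 0# = ℤ.0ℤ , ℤ.0ℤ
  ; 1# = ℤ.1ℤ , ℤ.0ℤ
  }

module ℤ[ψ] = RawRing ℤ[ψ]

-- m + n t is positive at the Fibonacci quotients t = 377/610 and t = 610/987, which enclose ψ.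
record Positive (p : ℤ × ℤ) : Set where
  constructor positive
  field
    at-lower : ℤ.0ℤ ℤ.< + 610 ℤ.* proj₁ p ℤ.+ + 377 ℤ.* proj₂ p
    at-upper : ℤ.0ℤ ℤ.< + 987 ℤ.* proj₁ p ℤ.+ + 610 ℤ.* proj₂ p

positive? : ∀ p → Dec (Positive p)
positive? p = map′ (uncurry positive) (λ (positive q r) → q , r)
  ((ℤ.0ℤ ℤ.<? _) ×-dec (ℤ.0ℤ ℤ.<? _))

module GoldenRatio (ℝ : CompleteOrderedField) (G : OrderedField.GoldenNumber ℝ) where
  open CompleteOrderedField ℝ
  open Dispersion ℝ
  open OrderedField ℝ
  open GoldenNumber G public

  -- The special cases make ψ and 1# available as solver constants up to definitional equality.
  ⟦_⟧ψ : ℤ × ℤ → Carrier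
  ⟦ + 1 , + 0 ⟧ψ = 1#
  ⟦ + 0 , + 1 ⟧ψ = ψ
  ⟦ m , + 0 ⟧ψ   = fromℤ m
  ⟦ m , n ⟧ψ     = fromℤ m + fromℤ n * ψ

  private
    module _ where
      open ℤ-Solver
      ⟦⟧-n0 : ∀ m → fromℤ m ≈ fromℤ m + 0# * ψ
      ⟦⟧-n0 m = solve 2 (λ m t → m := m :+ con ℤ.0ℤ :* t) refl (fromℤ m) ψ
      ⟦⟧-01 : ψ ≈ 0# + (1# + 0#) * ψ
      ⟦⟧-01 = solve 1 (λ t → t := con ℤ.0ℤ :+ con ℤ.1ℤ :* t) refl ψ

  ⟦⟧-expand : ∀ m n → ⟦ m , n ⟧ψ ≈ fromℤ m + fromℤ n * ψ
  ⟦⟧-expand (+ 0) (+ 0) = ⟦⟧-n0 (+ 0)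
  ⟦⟧-expand (+ 0) (+ 1) = ⟦⟧-01
  ⟦⟧-expand (+ 0) (+ suc (suc n)) = refl
  ⟦⟧-expand (+ 0) -[1+ n ] = refl
  ⟦⟧-expand (+ 1) (+ 0) = trans (sym (+-identityʳ 1#)) (⟦⟧-n0 (+ 1))
  ⟦⟧-expand (+ 1) (+ 1) = refl
  ⟦⟧-expand (+ 1) (+ suc (suc n)) = refl
  ⟦⟧-expand (+ 1) -[1+ n ] = refl
  ⟦⟧-expand (+ suc (suc m)) (+ 0) = ⟦⟧-n0 (+ suc (suc m))
  ⟦⟧-expand (+ suc (suc m)) (+ 1) = refl
  ⟦⟧-expand (+ suc (suc m)) (+ suc (suc n)) = refl
  ⟦⟧-expand (+ suc (suc m)) -[1+ n ] = refl
  ⟦⟧-expand -[1+ m ] (+ 0) = ⟦⟧-n0 -[1+ m ]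
  ⟦⟧-expand -[1+ m ] (+ 1) = refl
  ⟦⟧-expand -[1+ m ] (+ suc (suc n)) = refl
  ⟦⟧-expand -[1+ m ] -[1+ n ] = refl

  module Homomorphism where
    open ℤ-Solver

    ⟦⟧-+ : ∀ p q → ⟦ p ℤ[ψ].+ q ⟧ψ ≈ ⟦ p ⟧ψ + ⟦ q ⟧ψ
    ⟦⟧-+ (m , n) (m′ , n′) = trans (⟦⟧-expand (m ℤ.+ m′) (n ℤ.+ n′))
      (trans (+-cong (fromℤ-+ m m′) (*-congʳ (fromℤ-+ n n′)))
      (trans (solve 5 (λ m n m′ n′ t → m :+ m′ :+ (n :+ n′) :* t := m :+ n :* t :+ (m′ :+ n′ :* t))
        refl (fromℤ m) (fromℤ n) (fromℤ m′) (fromℤ n′) ψ)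
      (sym (+-cong (⟦⟧-expand m n) (⟦⟧-expand m′ n′)))))

    ⟦⟧-* : ∀ p q → ⟦ p ℤ[ψ].* q ⟧ψ ≈ ⟦ p ⟧ψ * ⟦ q ⟧ψ
    ⟦⟧-* (m , n) (m′ , n′) =
      trans (⟦⟧-expand (m ℤ.* m′ ℤ.+ n ℤ.* n′) (m ℤ.* n′ ℤ.+ n ℤ.* m′ ℤ.- n ℤ.* n′))
      (trans (+-cong
        (trans (fromℤ-+ (m ℤ.* m′) (n ℤ.* n′)) (+-cong (fromℤ-* m m′) (fromℤ-* n n′)))
        (*-congʳ (trans (fromℤ-+ (m ℤ.* n′ ℤ.+ n ℤ.* m′) (ℤ.- (n ℤ.* n′)))
          (+-cong (trans (fromℤ-+ (m ℤ.* n′) (n ℤ.* m′)) (+-cong (fromℤ-* m n′) (fromℤ-* n m′)))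
                  (trans (fromℤ-neg (n ℤ.* n′)) (-‿cong (fromℤ-* n n′)))))))
      (trans (solve 5 (λ m n m′ n′ t →
            m :* m′ :+ n :* n′ :+ (m :* n′ :+ n :* m′ :- n :* n′) :* t
          := (m :+ n :* t) :* (m′ :+ n′ :* t) :+ n :* n′ :* (con ℤ.1ℤ :- t :- t :* t))
        refl (fromℤ m) (fromℤ n) (fromℤ m′) (fromℤ n′) ψ)
      (trans (+-congˡ (trans (*-congˡ (trans (+-cong (+-congʳ (+-identityʳ 1#)) (-‿cong ψ²≈1-ψ))
                (-‿inverseʳ _))) (zeroʳ _)))
      (trans (+-identityʳ _)
      (sym (*-cong (⟦⟧-expand m n) (⟦⟧-expand m′ n′)))))))

    ⟦⟧-neg : ∀ p → ⟦ ℤ[ψ].- p ⟧ψ ≈ - ⟦ p ⟧ψ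
    ⟦⟧-neg (m , n) = trans (⟦⟧-expand (ℤ.- m) (ℤ.- n))
      (trans (+-cong (fromℤ-neg m) (*-congʳ (fromℤ-neg n)))
      (trans (solve 3 (λ m n t → :- m :+ :- n :* t := :- (m :+ n :* t)) refl (fromℤ m) (fromℤ n) ψ)
      (-‿cong (sym (⟦⟧-expand m n)))))

    ⟦⟧-≟ : ∀ p q → Maybe (⟦ p ⟧ψ ≈ ⟦ q ⟧ψ)
    ⟦⟧-≟ p q with ≡-dec ℤ._≟_ ℤ._≟_ p q
    ... | yes ≡.refl = just refl
    ... | no _       = nothing

  open Homomorphism public

  ⟦⟧-homo : ℤ[ψ] -Raw-AlmostCommutative⟶ fromCommutativeRing commutativeRing
  ⟦⟧-homo = record
    { ⟦_⟧ = ⟦_⟧ψ ; +-homo = ⟦⟧-+ ; *-homo = ⟦⟧-* ; -‿homo = ⟦⟧-neg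
    ; 0-homo = refl ; 1-homo = refl }

  -- Constants are computed in ℤ[ψ], so normalisation applies ψ² = 1 - ψ silently.
  module ψ-Solver = Algebra.Solver.Ring ℤ[ψ] (fromCommutativeRing commutativeRing) ⟦⟧-homo ⟦⟧-≟

  open ψ-Solver public

  fromℤ>0 : ∀ {i} → ℤ.0ℤ ℤ.< i → fromℤ i >0
  fromℤ>0 {+ suc n} _ = 1+n>0 n
  fromℤ>0 {+ zero} (ℤ.+<+ ())

  private
    -- 610 ψ - 377 is a unit of ℤ[ψ] with the visibly positive inverse 987 + 610 ψ. In the same way
    -- 610 - 987 ψ has the inverse 1597 + 987 ψ.
    lower>0 : ⟦ -[1+ 376 ] , + 610 ⟧ψ >0
    lower>0 with ≤∨> ⟦ -[1+ 376 ] , + 610 ⟧ψ 0#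
    ... | inj₂ p = p
    ... | inj₁ p = contradiction
      (≤⇒≥0 p *₀ (n≥0 987 +₀ n≥0 610 *₀ inj₁ ψ>0))
      (<⇒≱ (<-by 1>0 (solve 0 (con (+ 0 , + 0) :- (con (+ 0 , + 0) :- con (-[1+ 376 ] , + 610)) :*
        (con (+ 987 , + 0) :+ con (+ 610 , + 0) :* con (+ 0 , + 1)) := con (+ 1 , + 0)) refl)))

    upper>0 : ⟦ + 610 , -[1+ 986 ] ⟧ψ >0
    upper>0 with ≤∨> ⟦ + 610 , -[1+ 986 ] ⟧ψ 0#
    ... | inj₂ p = p
    ... | inj₁ p = contradiction
      (≤⇒≥0 p *₀ (n≥0 1597 +₀ n≥0 987 *₀ inj₁ ψ>0))
      (<⇒≱ (<-by 1>0 (solve 0 (con (+ 0 , + 0) :- (con (+ 0 , + 0) :- con (+ 610 , -[1+ 986 ])) :*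
        (con (+ 1597 , + 0) :+ con (+ 987 , + 0) :* con (+ 0 , + 1)) := con (+ 1 , + 0)) refl)))

  -- Since 610 · 610 - 377 · 987 = 1, m + n ψ is the combination of the test values 610 m + 377 n
  -- and 987 m + 610 n with the positive coefficients 610 - 987 ψ and 610 ψ - 377.
  ⟦⟧>0 : ∀ p → Positive p → ⟦ p ⟧ψ >0
  ⟦⟧>0 (m , n) (positive q r) = <-respʳ-≈
    (trans (+-cong (*-congˡ (expand 610 377)) (*-congˡ (expand 987 610)))
      (trans (solve 2 (λ m n →
          con (+ 610 , -[1+ 986 ]) :* (con (+ 610 , + 0) :* m :+ con (+ 377 , + 0) :* n)
          :+ con (-[1+ 376 ] , + 610) :* (con (+ 987 , + 0) :* m :+ con (+ 610 , + 0) :* n)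
          := m :+ n :* con (+ 0 , + 1)) refl (fromℤ m) (fromℤ n))
        (sym (⟦⟧-expand m n))))
    (upper>0 *₊ fromℤ>0 q +₊ inj₁ (lower>0 *₊ fromℤ>0 r))
    where
    expand : ∀ j k → fromℤ (+ j ℤ.* m ℤ.+ + k ℤ.* n) ≈ j ⋆ 1# * fromℤ m + k ⋆ 1# * fromℤ n
    expand j k = trans (fromℤ-+ (+ j ℤ.* m) (+ k ℤ.* n)) (+-cong (fromℤ-* (+ j) m) (fromℤ-* (+ k) n))

  literal>0 : ∀ p {_ : True (positive? p)} → ⟦ p ⟧ψ >0
  literal>0 p {pos} = ⟦⟧>0 p (toWitness pos)

-- Orbits of denominators and eventual properties.

-- The denominators (a , b) of a Farey pair whose lengths have the ratio 1 : ψ.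
State : Set
State = ℕ × ℕ

next : State → State
next (a , b) = b , a ℕ.+ b

next^ : ℕ → State → State
next^ zero    s = s
next^ (suc k) s = next^ k (next s)

next^-+ : ∀ j k s → next^ (j ℕ.+ k) s ≡ next^ k (next^ j s)
next^-+ zero    k s = ≡.refl
next^-+ (suc j) k s = next^-+ j k (next s)

next^-suc : ∀ k s → next^ (suc k) s ≡ next (next^ k s)
next^-suc zero    s = ≡.refl
next^-suc (suc k) s = next^-suc k (next s)

total : State → ℕ
total (a , b) = a ℕ.+ b

AllPositive : State → Set
AllPositive (a , b) = 1 ℕ.≤ a × 1 ℕ.≤ b

positive-next : ∀ s → AllPositive s → AllPositive (next s)
positive-next (a , b) (1≤a , 1≤b) = 1≤b , ℕ.≤-trans 1≤a (ℕ.m≤m+n a b)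

positive-next^ : ∀ k s → AllPositive s → AllPositive (next^ k s)
positive-next^ zero    s p = p
positive-next^ (suc k) s p = positive-next^ k (next s) (positive-next s p)

total-next^ : ∀ k s → AllPositive s → k ℕ.+ total s ℕ.≤ total (next^ k s)
total-next^ zero    s p = ℕ.≤-refl
total-next^ (suc k) s@(a , b) p = ℕ.≤-trans
  (ℕ.≤-trans (ℕ.≤-reflexive (≡.sym (ℕ.+-suc k (a ℕ.+ b))))
    (ℕ.+-monoʳ-≤ k (ℕ.+-monoˡ-≤ (a ℕ.+ b) (proj₂ p))))
  (total-next^ k (next s) (positive-next s p))

Eventually : (ℕ → Set) → Set
Eventually P = ∃[ K ] ∀ k → K ℕ.≤ k → P k

eventually-map : ∀ {P Q : ℕ → Set} → (∀ k → P k → Q k) → Eventually P → Eventually Q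
eventually-map f (K , p) = K , λ k K≤k → f k (p k K≤k)

eventually-× : ∀ {P Q : ℕ → Set} → Eventually P → Eventually Q → Eventually (λ k → P k × Q k)
eventually-× (K , p) (L , q) = K ℕ.⊔ L , λ k h →
  p k (ℕ.≤-trans (ℕ.m≤m⊔n K L) h) , q k (ℕ.≤-trans (ℕ.m≤n⊔m K L) h)

eventually-All : ∀ {A : Set} {P : A → ℕ → Set} {xs} →
                 All (λ x → Eventually (P x)) xs → Eventually (λ k → All (λ x → P x k) xs)
eventually-All []       = 0 , λ _ _ → []
eventually-All (p ∷ ps) =
  eventually-map (λ _ (q , qs) → q ∷ qs) (eventually-× p (eventually-All ps))

eventually-shift : ∀ {P : ℕ → Set} j → Eventually (λ k → P (j ℕ.+ k)) → Eventually P
eventually-shift {P} j (K , p) = j ℕ.+ K , λ k h →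
  ≡.subst P (ℕ.m+[n∸m]≡n (ℕ.≤-trans (ℕ.m≤m+n j K) h))
    (p (k ℕ.∸ j) (≡.subst (ℕ._≤ k ℕ.∸ j) (ℕ.m+n∸m≡n j K) (ℕ.∸-monoˡ-≤ j h)))

-- The finite search, carried out on integer forms.

-- (α , β) stands for the form α x + β y in the lengths x ≥ y of a Farey pair.
Form : Set
Form = ℤ × ℤ

-- A nonnegative combination of the two forms is a negative multiple of y.
Refutes : Form → Form → Set
Refutes (α , β) (α′ , β′) =
  ℤ.0ℤ ℤ.≤ α × α′ ℤ.≤ ℤ.0ℤ × α ℤ.* β′ ℤ.- α′ ℤ.* β ℤ.< ℤ.0ℤ

Inconsistent : List Form → Set
Inconsistent Γ = Any (λ p → Any (Refutes p) Γ) Γ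

inconsistent? : ∀ Γ → Dec (Inconsistent Γ)
inconsistent? Γ = any? (λ p → any? (refutes? p) Γ) Γ
  where
  refutes? : ∀ p q → Dec (Refutes p q)
  refutes? (α , β) (α′ , β′) = (ℤ.0ℤ ℤ.≤? α) ×-dec (α′ ℤ.≤? ℤ.0ℤ) ×-dec (_ ℤ.<? ℤ.0ℤ)

-- The constraints are forms that must be nonnegative, the values are the (a + b - 1) (x + y) of
-- all predecessors, and the origin is the distance of θ to the nearest integer; all of them are
-- expressed in the current lengths x ≥ y.
record Node : Set where
  constructor node
  field
    denominators : State
    origin       : Form
    values       : List Form
    constraints  : List Form

-- The lengths (x , y) become (y , x - y) or (x - y , y).
slow fast : Form → Form
slow (α , β) = α ℤ.+ β , α
fast (α , β) = α , α ℤ.+ β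

-- Nonnegative by (a + b - 1) (x + y) ≤ c < 3789/2000, made homogeneous by a y + b x = 1.
valueBound : State → Form
valueBound (a , b) = + 3789 ℤ.* + b ℤ.- k , + 3789 ℤ.* + a ℤ.- k
  where k = + 2000 ℤ.* (+ a ℤ.+ + b ℤ.- ℤ.1ℤ)

-- `(k , k)` bounds the scaled gaps at the indices between the old pair and the new one; the form (1
-- , -1) records x ≥ y.
extend : (Form → Form) → Node → State → Node
extend σ n s@(a , b) = node s (σ (Node.origin n))
  ((k , k) ∷ map σ (Node.values n))
  ((ℤ.1ℤ , ℤ.-1ℤ) ∷ valueBound s ∷ map σ (Node.constraints n))
  where k = + a ℤ.+ + b ℤ.- ℤ.1ℤ

slowChild fastChild : Node → Node
slowChild n@(node (a , b) _ _ _) = extend slow n (b , a ℕ.+ b)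
fastChild n@(node (a , b) _ _ _) = extend fast n (a ℕ.+ b , b)

prune : Node → List Node → List Node
prune n ns = if does (inconsistent? (Node.constraints n)) then [] else ns

search : ℕ → Node → List Node
search zero    n = n ∷ []
search (suc k) n = prune (slowChild n) (search k (slowChild n)) ++
                   prune (fastChild n) (search k (fastChild n))

root : Node
root = node (1 , 1) (+ 0 , + 1) [] []

-- Depth 9 is enough for `leaves-golden`: by then the constraints on every surviving branch exclude
-- x ≥ 211/2000.
leaves : List Node
leaves = search 9 root

-- Nonnegative if x ≥ 211/2000, which lies below 2 - c; the right-hand side is multiplied by
-- a y + b x = 1 to make the form homogeneous.
notSmall : State → Form
notSmall (a , b) = + 2000 ℤ.- + 211 ℤ.* + b , ℤ.- (+ 211 ℤ.* + a)

infixl 6 _ℤ[ψ]-_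
_ℤ[ψ]-_ : ℤ × ℤ → ℤ × ℤ → ℤ × ℤ
p ℤ[ψ]- q = p ℤ[ψ].+ (ℤ[ψ].- q)

-- ∣ b - a (1 + ψ) ∣ < 1.
SmallError : State → Set
SmallError (a , b) = Positive (ℤ.1ℤ ℤ.- (+ b ℤ.- + a) , + a)
                   × Positive (ℤ.1ℤ ℤ.+ (+ b ℤ.- + a) , ℤ.- + a)

-- 5 p < 5 c = 7 + 4 ψ for y = ψ x, multiplied by the weight b + a ψ = 1/x.
BelowC : State → Form → Set
BelowC (a , b) p = Positive (((+ 7 , + 4) ℤ[ψ].* (+ b , + a)) ℤ[ψ]- ((+ 5 , + 0) ℤ[ψ].* p))

-- Refuting `notSmall` forces y = ψ x, the small error makes all later values increase, and the
-- strict bounds let these values overtake the finitely many earlier ones.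
GoldenLeaf : Node → Set
GoldenLeaf (node s _ vs Γ) =
  AllPositive s × Inconsistent (notSmall s ∷ Γ) × SmallError s × All (BelowC s) vs

goldenLeaf? : ∀ n → Dec (GoldenLeaf n)
goldenLeaf? (node s _ vs Γ) =
  ((1 ℕ.≤? proj₁ s) ×-dec (1 ℕ.≤? proj₂ s)) ×-dec inconsistent? (notSmall s ∷ Γ) ×-dec
  (positive? _ ×-dec positive? _) ×-dec all? (λ _ → positive? _) vs

weightForm : State → ℤ × ℤ
weightForm (a , b) = + b , + a

-- `next` multiplies weights by 1 + ψ, so a weight strictly inside one period of the orbit of `s` is
-- none of the weights of that orbit. The shifts below 6 in `Distinguished` align the periods of two
-- leaves.
InterlacedForm : State → State → Set
InterlacedForm s s′ = Positive (weightForm s′ ℤ[ψ]- weightForm s)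
                    × Positive (weightForm (next s) ℤ[ψ]- weightForm s′)

key : Node → State × Form
key n = Node.denominators n , Node.origin n

Distinguished : Node → Node → Set
Distinguished n n′ = key n ≡ key n′ ⊎ Any (λ i → Any (λ j → InterlacedForm
  (next^ i (Node.denominators n)) (next^ j (Node.denominators n′))) (upTo 6)) (upTo 6)

distinguished? : ∀ n n′ → Dec (Distinguished n n′)
distinguished? n n′ = ≡-dec (≡-dec ℕ._≟_ ℕ._≟_) (≡-dec ℤ._≟_ ℤ._≟_) (key n) (key n′) ⊎-dec
  any? (λ i → any? (λ j → positive? _ ×-dec positive? _) (upTo 6)) (upTo 6)

leaves-golden : All GoldenLeaf leaves
leaves-golden = from-yes (all? goldenLeaf? leaves)

leaves-distinguished : All (λ n → All (Distinguished n) leaves) leaves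
leaves-distinguished = from-yes (all? (λ n → all? (distinguished? n) leaves) leaves)

-- Values along an orbit, their deficits and their comparison.

module CriticalDispersion (ℝ : CompleteOrderedField) (em : ExcludedMiddle 0ℓ)
  (G : OrderedField.GoldenNumber ℝ) (C : OrderedField.CriticalValue ℝ G) where
  open CompleteOrderedField ℝ
  open Dispersion ℝ
  open OrderedField ℝ
  open CriticalValue C
  open FareyPairs ℝ
  open GoldenRatio ℝ G

  # : ∀ {n} → ℕ → Polynomial n
  # k = con (+ k , + 0)

  ψ′ : ∀ {n} → Polynomial n
  ψ′ = con (+ 0 , + 1)

  φ : Carrier
  φ = 1# + ψ

  φ>0 : φ >0
  φ>0 = 1>0 +₊ inj₁ ψ>0

  φ^ : ℕ → Carrier
  φ^ zero    = 1#
  φ^ (suc k) = φ^ k * φ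

  bernoulli : ∀ k → 1# + k ⋆ 1# * ψ ≤ φ^ k
  bernoulli zero = inj₂ (solve 0 (# 1 :+ # 0 :* ψ′ := # 1) refl)
  bernoulli (suc k) = ≤-by (≤⇒≥0 (bernoulli k) *₀ inj₁ φ>0 +₀ n≥0 k *₀ (inj₁ ψ>0 *₀ inj₁ ψ>0))
    (solve 2 (λ p k → p :* (# 1 :+ ψ′) :- (# 1 :+ (# 1 :+ k) :* ψ′) :=
      (p :- (# 1 :+ k :* ψ′)) :* (# 1 :+ ψ′) :+ k :* (ψ′ :* ψ′)) refl (φ^ k) (k ⋆ 1#))

  growth : ∀ C {D} → D >0 → Eventually (λ k → C < φ^ k * D)
  growth C {D} D>0 = let (n , C<nψD) = archimedean-* em C (ψ>0 *₊ D>0) in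
    n , λ k n≤k → <-≤-trans C<nψD
    (≤-by ((≤⇒≥0 (bernoulli k) +₀ inj₁ 1>0 +₀ ≤⇒≥0 (⋆-mono n≤k) *₀ inj₁ ψ>0) *₀ inj₁ D>0)
      (solve 4 (λ p k n D → p :* D :- n :* (ψ′ :* D) :=
        (p :- (# 1 :+ k :* ψ′) :+ # 1 :+ (k :- n) :* ψ′) :* D) refl (φ^ k) (k ⋆ 1#) (n ⋆ 1#) D))

  -- Eigenforms of `next` with eigenvalues φ and - ψ. Linear functions of (a , b) split into a
  -- growing part along `weight` and a bounded part along `error`.
  weight error : State → Carrier
  weight (a , b) = b ⋆ 1# + a ⋆ 1# * ψ
  error (a , b)  = b ⋆ 1# - a ⋆ 1# * φ

  weight-next : ∀ s → weight (next s) ≈ φ * weight s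
  weight-next (a , b) = trans (+-congʳ (×-homo-+ 1# a b))
    (solve 2 (λ A B → A :+ B :+ B :* ψ′ := (# 1 :+ ψ′) :* (B :+ A :* ψ′)) refl (a ⋆ 1#) (b ⋆ 1#))

  error-next : ∀ s → error (next s) ≈ - (ψ * error s)
  error-next (a , b) = trans (+-congʳ (×-homo-+ 1# a b))
    (solve 2 (λ A B → A :+ B :- B :* (# 1 :+ ψ′) := :- (ψ′ :* (B :- A :* (# 1 :+ ψ′))))
      refl (a ⋆ 1#) (b ⋆ 1#))

  weight-next^ : ∀ k s → weight (next^ k s) ≈ φ^ k * weight s
  weight-next^ zero    s = sym (*-identityˡ _)
  weight-next^ (suc k) s = trans (weight-next^ k (next s))
    (trans (*-congˡ (weight-next s)) (sym (*-assoc _ _ _)))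

  error-next^ : ∀ k s → φ^ k * error (next^ k s) ≈ error s ⊎ φ^ k * error (next^ k s) ≈ - error s
  error-next^ zero    s = inj₁ (*-identityˡ _)
  error-next^ (suc k) s with error-next^ k (next s)
  ... | inj₁ eq = inj₂ (trans
      (solve 2 (λ p e → p :* (# 1 :+ ψ′) :* e := (# 1 :+ ψ′) :* (p :* e)) refl _ _)
    (trans (*-congˡ (trans eq (error-next s)))
      (solve 1 (λ e → (# 1 :+ ψ′) :* :- (ψ′ :* e) := :- e) refl (error s))))
  ... | inj₂ eq = inj₁ (trans
      (solve 2 (λ p e → p :* (# 1 :+ ψ′) :* e := (# 1 :+ ψ′) :* (p :* e)) refl _ _)
    (trans (*-congˡ (trans eq (-‿cong (error-next s))))
      (solve 1 (λ e → (# 1 :+ ψ′) :* :- :- (ψ′ :* e) := e) refl (error s))))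

  ∣_∣≤1 : Carrier → Set
  ∣ x ∣≤1 = 1# - x ≥0 × 1# + x ≥0

  ∣∣≤1-resp : ∀ {x y} → x ≈ y → ∣ x ∣≤1 → ∣ y ∣≤1
  ∣∣≤1-resp x≈y (p , q) = ≥0-resp (+-congˡ (-‿cong x≈y)) p , ≥0-resp (+-congˡ x≈y) q

  ∣-∣≤1 : ∀ {x} → ∣ x ∣≤1 → ∣ - x ∣≤1
  ∣-∣≤1 {x} (p , q) = ≥0-resp (solve 1 (λ x → # 1 :+ x := # 1 :- :- x) refl x) q , p

  1-ψ>0 : 1# - ψ >0
  1-ψ>0 = <-respʳ-≈ ψ²≈1-ψ (ψ>0 *₊ ψ>0)

  ∣ψ*∣≤1 : ∀ {x} → ∣ x ∣≤1 → ∣ ψ * x ∣≤1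
  ∣ψ*∣≤1 {x} (p , q) =
    ≥0-resp (solve 1 (λ x → # 1 :- ψ′ :+ ψ′ :* (# 1 :- x) := # 1 :- ψ′ :* x) refl x)
      (inj₁ 1-ψ>0 +₀ inj₁ ψ>0 *₀ p) ,
    ≥0-resp (solve 1 (λ x → # 1 :- ψ′ :+ ψ′ :* (# 1 :+ x) := # 1 :+ ψ′ :* x) refl x)
      (inj₁ 1-ψ>0 +₀ inj₁ ψ>0 *₀ q)

  small-next : ∀ s → ∣ error s ∣≤1 → ∣ error (next s) ∣≤1
  small-next s h = ∣∣≤1-resp (sym (error-next s)) (∣-∣≤1 (∣ψ*∣≤1 h))

  small-next^ : ∀ k s → ∣ error s ∣≤1 → ∣ error (next^ k s) ∣≤1
  small-next^ zero    s h = h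
  small-next^ (suc k) s h = small-next^ k (next s) (small-next s h)

  small-scaled : ∀ k s → ∣ error s ∣≤1 → ∣ φ^ k * error (next^ k s) ∣≤1
  small-scaled k s h with error-next^ k s
  ... | inj₁ eq = ∣∣≤1-resp (sym eq) h
  ... | inj₂ eq = ∣∣≤1-resp (sym eq) (∣-∣≤1 h)

  size : State → Carrier
  size (a , b) = a ⋆ 1# + b ⋆ 1#

  -- 5 (c - value s X) = X (λ₀ + κ error s).
  κ λ₀ : Carrier
  κ  = ⟦ + 2 , -[1+ 0 ] ⟧ψ
  λ₀ = ⟦ + 5 , + 5 ⟧ψ

  κ′ λ′ : ∀ {n} → Polynomial n
  κ′ = con (+ 2 , -[1+ 0 ])
  λ′ = con (+ 5 , + 5)

  κ>0 : κ >0
  κ>0 = literal>0 (+ 2 , -[1+ 0 ])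

  λ₀>0 : λ₀ >0
  λ₀>0 = literal>0 (+ 5 , + 5)

  -- The largest of the (m + 1) d(m) with a gap of length X + ψ X.
  value : State → Carrier → Carrier
  value s X = (size s - 1#) * (X + ψ * X)

  deficit : State → Carrier
  deficit s = λ₀ + κ * error s

  Reciprocal : State → Carrier → Set
  Reciprocal s X = X >0 × X * weight s ≈ 1#

  -- Since 5 φ size s = (7 + 4 ψ) weight s - κ error s and X weight s = 1, the leading part is the
  -- constant 5 c. The term λ₀ = 5 φ stems from the - 1 in size s - 1.
  5value : ∀ s {X} → X * weight s ≈ 1# → 5 ⋆ 1# * value s X ≈ 5 ⋆ 1# * c - X * deficit s
  5value (a , b) {X} Xw≈1 = trans
    (solve 3 (λ A B X → # 5 :* ((A :+ B :- # 1) :* (X :+ ψ′ :* X)) :=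
        con (+ 7 , + 4) :* (X :* (B :+ A :* ψ′)) :- X :* (λ′ :+ κ′ :* (B :- A :* (# 1 :+ ψ′))))
      refl (a ⋆ 1#) (b ⋆ 1#) X)
    (+-congʳ (trans (*-congˡ Xw≈1) (trans (*-identityʳ _) (sym 5c≈7+4ψ))))

  reciprocal-next : ∀ s {X} → Reciprocal s X → Reciprocal (next s) (ψ * X)
  reciprocal-next s {X} (X>0 , eq) = ψ>0 *₊ X>0 ,
    trans (*-congˡ (weight-next s))
      (trans (solve 2 (λ X w → ψ′ :* X :* ((# 1 :+ ψ′) :* w) := X :* w) refl X (weight s)) eq)

  -- Five times the increase is X (10 ψ - 5 + (5 - 5 ψ) (1 + error s)), and ψ > 1/2.
  value-next : ∀ s {X} → Reciprocal s X → ∣ error s ∣≤1 → value s X ≤ value (next s) (ψ * X)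
  value-next s {X} r@(X>0 , eq) (_ , q) = *-cancelˡ-≤ (1+n>0 4) (≤-by
    (inj₁ X>0 *₀ (inj₁ (literal>0 (-[1+ 4 ] , + 10))
      +₀ inj₁ (literal>0 (+ 5 , -[1+ 4 ])) *₀ q))
    (trans (+-cong (5value (next s) (proj₂ (reciprocal-next s r))) (-‿cong (5value s eq)))
      (trans (+-congʳ (+-congˡ (-‿cong (*-congˡ (+-congˡ (*-congˡ (error-next s)))))))
        (solve 3 (λ c X e → c :- ψ′ :* X :* (λ′ :+ κ′ :* :- (ψ′ :* e)) :- (c :- X :* (λ′ :+ κ′ :* e))
          := X :* (con (-[1+ 4 ] , + 10) :+ con (+ 5 , -[1+ 4 ]) :* (# 1 :+ e)))
        refl (5 ⋆ 1# * c) X (error s)))))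

  -- Two points before the gap of length X is split, (m + 1) d(m) has not yet
  -- outgrown the value of s.
  value-late : ∀ s {X} → Reciprocal s X → ∣ error s ∣≤1 →
               (size (next s) - fromℤ (+ 2)) * X ≤ value s X
  value-late s@(a , b) {X} r@(X>0 , eq) (p , _) = *-cancelˡ-≤ (1+n>0 4) (≤-by
    (inj₁ X>0 *₀ inj₁ (literal>0 (+ 5 , -[1+ 4 ])) *₀ p)
    (trans (+-cong (5value s eq) (-‿cong (trans
        (trans (*-congˡ (trans (*-congʳ (+-congʳ (+-congˡ (×-homo-+ 1# a b))))
            (solve 3 (λ A B X → (B :+ (A :+ B) :- # 2) :* X :=
              (B :+ (A :+ B) :- # 1) :* (ψ′ :* X :+ ψ′ :* (ψ′ :* X)) :- X) refl (a ⋆ 1#) (b ⋆ 1#) X)))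
          (trans (*-congˡ (+-congʳ (*-congʳ (+-congʳ (+-congˡ (sym (×-homo-+ 1# a b)))))))
            (solve 2 (λ v X → # 5 :* (v :- X) := # 5 :* v :- # 5 :* X) refl _ X)))
        (+-congʳ (trans (5value (next s) (proj₂ (reciprocal-next s r)))
          (+-congˡ (-‿cong (*-congˡ (+-congˡ (*-congˡ (error-next s)))))))))))
      (solve 3 (λ c X e → c :- X :* (λ′ :+ κ′ :* e) :-
          (c :- ψ′ :* X :* (λ′ :+ κ′ :* :- (ψ′ :* e)) :- # 5 :* X)
          := X :* con (+ 5 , -[1+ 4 ]) :* (# 1 :- e))
        refl (5 ⋆ 1# * c) X (error s))))

  shrink : ℕ → Carrier → Carrier
  shrink zero    X = X
  shrink (suc k) X = shrink k (ψ * X)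

  reciprocal-next^ : ∀ k s {X} → Reciprocal s X → Reciprocal (next^ k s) (shrink k X)
  reciprocal-next^ zero    s r = r
  reciprocal-next^ (suc k) s r = reciprocal-next^ k (next s) (reciprocal-next s r)

  value-next^ : ∀ k s {X} → Reciprocal s X → ∣ error s ∣≤1 →
                value s X ≤ value (next^ k s) (shrink k X)
  value-next^ zero    s r h = ≤-refl
  value-next^ (suc k) s r h = ≤-trans (value-next s r h)
    (value-next^ k (next s) (reciprocal-next s r) (small-next s h))

  weight≥0 : ∀ s → weight s ≥0
  weight≥0 (a , b) = n≥0 b +₀ n≥0 a *₀ inj₁ ψ>0

  weight>0 : ∀ s {X} → Reciprocal s X → weight s >0
  weight>0 s {X} (X>0 , eq) with weight≥0 s
  ... | inj₁ p = p
  ... | inj₂ p = contradiction (trans (trans (sym (zeroʳ X)) (*-congˡ p)) eq) 0≉1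

  -- The deficit stays at most λ₀ + κ while the length, being 1/weight, decays like 1/φ^k; so the
  -- values tend to c.
  value-limit : ∀ s {X v} → Reciprocal s X → ∣ error s ∣≤1 → v < c →
                Eventually (λ k → v ≤ value (next^ k s) (shrink k X))
  value-limit s {X} {v} r h v<c = eventually-map close
    (growth (λ₀ + κ) (weight>0 s r *₊ (1+n>0 4 *₊ <⇒>0 v<c)))
    where
    close : ∀ k → λ₀ + κ < φ^ k * (weight s * (5 ⋆ 1# * (c - v))) →
            v ≤ value (next^ k s) (shrink k X)
    close k large = *-cancelˡ-≤ (1+n>0 4) (≤-by
      (inj₁ Y>0 *₀ (inj₁ (<⇒>0 large) +₀ inj₁ κ>0 *₀ proj₁ (small-next^ k s h)))
      (trans (+-congʳ (5value t eq))
        (trans (sym (+-identityʳ _))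
        (trans (+-congˡ (sym (trans (*-congʳ vanish) (zeroˡ (5 ⋆ 1# * (c - v))))))
        (solve 7 (λ p w c v Y e W → # 5 :* c :- Y :* (λ′ :+ κ′ :* e) :- # 5 :* v :+
            (Y :* (p :* w) :- # 1) :* (# 5 :* (c :- v))
          := Y :* (p :* (w :* (# 5 :* (c :- v))) :- (λ′ :+ κ′) :+ κ′ :* (# 1 :- e)))
          refl (φ^ k) (weight s) c v Y (error t) (weight t))))))
      where
      t = next^ k s
      Y = shrink k X
      Y>0 = proj₁ (reciprocal-next^ k s r)
      eq = proj₂ (reciprocal-next^ k s r)
      vanish : Y * (φ^ k * weight s) - 1# ≈ 0#
      vanish = trans (+-congʳ (trans (*-congˡ (sym (weight-next^ k s))) eq)) (-‿inverseʳ 1#)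

  -- The value of t′ exceeds that of t and is attained before that of next t.
  Overtakes : State → State → Set
  Overtakes t t′ = size t′ < size (next t) × weight t * deficit t′ < weight t′ * deficit t

  Interlaced : State → State → Set
  Interlaced s s′ = weight s < weight s′ × weight s′ < weight (next s)

  private
    size-weight : ∀ s → (5 ⋆ 1# * φ) * size s ≈ ⟦ + 7 , + 4 ⟧ψ * weight s - κ * error s
    size-weight (a , b) = solve 2 (λ A B → # 5 :* (# 1 :+ ψ′) :* (A :+ B) :=
      con (+ 7 , + 4) :* (B :+ A :* ψ′) :- κ′ :* (B :- A :* (# 1 :+ ψ′))) refl (a ⋆ 1#) (b ⋆ 1#)

  -- Interlacing settles both inequalities for the parts along `weight`, where the differences grow
  -- like φ^k; the terms with `error` remain bounded.
  overtakes : ∀ s s′ → ∣ error s ∣≤1 → ∣ error s′ ∣≤1 → Interlaced s s′ →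
              Eventually (λ k → Overtakes (next^ k s) (next^ k s′))
  overtakes s s′ h h′ (w<w′ , w′<φw) = eventually-× sizes deficits
    where
    sizes : Eventually (λ k → size (next^ k s′) < size (next (next^ k s)))
    sizes = eventually-map larger (growth (fromℤ (+ 2) * κ) (literal>0 (+ 7 , + 4) *₊ <⇒>0 w′<φw))
      where
      larger : ∀ k → fromℤ (+ 2) * κ < φ^ k * (⟦ + 7 , + 4 ⟧ψ * (weight (next s) - weight s′)) →
               size (next^ k s′) < size (next (next^ k s))
      larger k large = ≡.subst (λ u → size t′ < size u) (next^-suc k s)
        (*-cancelˡ-< (1+n>0 4 *₊ φ>0) (<-by
          (<⇒>0 large +₊ inj₁ κ>0 *₀ (proj₁ (small-next^ k (next s) (small-next s h)) +₀
                                      proj₂ (small-next^ k s′ h′)))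
          (trans (+-cong (size-weight u) (-‿cong (size-weight t′)))
            (trans (+-cong (+-congʳ (*-congˡ (weight-next^ k (next s))))
                           (-‿cong (+-congʳ (*-congˡ (weight-next^ k s′)))))
              (solve 5 (λ p w w′ e e′ →
                  con (+ 7 , + 4) :* (p :* w) :- κ′ :* e :- (con (+ 7 , + 4) :* (p :* w′) :- κ′ :* e′)
                  := p :* (con (+ 7 , + 4) :* (w :- w′)) :- # 2 :* κ′ :+ κ′ :* (# 1 :- e :+ (# 1 :+ e′)))
                refl (φ^ k) (weight (next s)) (weight s′) (error u) (error t′))))))
        where
        u = next^ k (next s)
        t′ = next^ k s′

    deficits : Eventually (λ k → weight (next^ k s) * deficit (next^ k s′) <
                                 weight (next^ k s′) * deficit (next^ k s))
    deficits = eventually-map larger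
      (growth (κ * (weight s + weight s′)) (λ₀>0 *₊ <⇒>0 w<w′))
      where
      larger : ∀ k → κ * (weight s + weight s′) < φ^ k * (λ₀ * (weight s′ - weight s)) →
               weight (next^ k s) * deficit (next^ k s′) < weight (next^ k s′) * deficit (next^ k s)
      larger k large = <-by
        (<⇒>0 large +₊ inj₁ κ>0 *₀ (weight≥0 s′ *₀ proj₂ (small-scaled k s h) +₀
                                    weight≥0 s *₀ proj₁ (small-scaled k s′ h′)))
        (trans (+-cong (*-congʳ (weight-next^ k s′)) (-‿cong (*-congʳ (weight-next^ k s))))
          (solve 5 (λ p w w′ e e′ →
              p :* w′ :* (λ′ :+ κ′ :* e) :- p :* w :* (λ′ :+ κ′ :* e′)
              := p :* (λ′ :* (w′ :- w)) :- κ′ :* (w :+ w′) :+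
                 κ′ :* (w′ :* (# 1 :+ p :* e) :+ w :* (# 1 :- p :* e′)))
            refl (φ^ k) (weight s) (weight s′) (error (next^ k s)) (error (next^ k s′))))

  value-< : ∀ s s′ {X X′} → Reciprocal s X → Reciprocal s′ X′ →
            weight s * deficit s′ < weight s′ * deficit s → value s X < value s′ X′
  value-< s s′ {X} {X′} (X>0 , eq) (X′>0 , eq′) p = *-cancelˡ-< (1+n>0 4) (<-by
    (X>0 *₊ X′>0 *₊ <⇒>0 p)
    (trans (+-cong (5value s′ eq′) (-‿cong (5value s eq)))
      (trans (solve 5 (λ c X X′ d d′ →
            c :- X′ :* d′ :- (c :- X :* d) := # 1 :* (X :* d) :- # 1 :* (X′ :* d′))
          refl (5 ⋆ 1# * c) X X′ (deficit s) (deficit s′))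
        (trans (+-cong (*-congʳ (sym eq′)) (-‿cong (*-congʳ (sym eq))))
          (solve 6 (λ X X′ d d′ w w′ → X′ :* w′ :* (X :* d) :- X :* w :* (X′ :* d′) :=
              X :* X′ :* (w′ :* d :- w :* d′))
            refl X X′ (deficit s) (deficit s′) (weight s) (weight s′))))))

  -- Dispersion of a number with a golden pair.

  record Golden (θ : Carrier) (s : State) (X : Carrier) : Set where
    constructor golden
    field
      pair : FareyPair± θ (proj₁ s) X (proj₂ s) (ψ * X)
      X>0  : X >0

    reciprocal : Reciprocal s X
    reciprocal = X>0 , trans
      (solve 3 (λ X A B → X :* (B :+ A :* ψ′) := A :* (ψ′ :* X) :+ B :* X) refl X _ _)
      (determinant± pair)

  open Golden

  golden-next : ∀ {θ s X} → Golden θ s X → Golden θ (next s) (ψ * X)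
  golden-next {X = X} (golden pair X>0) = golden
    (FareyPair±-resp refl (solve 1 (λ X → X :- ψ′ :* X := ψ′ :* (ψ′ :* X)) refl X) (swap (step pair)))
    (ψ>0 *₊ X>0)

  golden-next^ : ∀ k {θ s X} → Golden θ s X → Golden θ (next^ k s) (shrink k X)
  golden-next^ zero    g = g
  golden-next^ (suc k) g = golden-next^ k (golden-next g)

  scaled-lower : ∀ {θ a x b y m} → FareyPair± θ a x b y → x ≥0 → y ≥0 → 2 ℕ.+ m ≡ a ℕ.+ b →
                 (a ⋆ 1# + b ⋆ 1# - 1#) * (x + y) ≤ scaledGap θ m
  scaled-lower {θ} {a} {x} {b} {y} {m} F x≥0 y≥0 2+m≡a+b =
    ≤-by (n≥0 (suc m) *₀ ≤⇒≥0 (gap-lower± F x≥0 y≥0 (ℕ.≤-reflexive 2+m≡a+b)))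
      (trans (+-cong (⋆-as-* (suc m) (d θ m)) (-‿cong (*-congʳ (trans
          (+-congʳ (trans (sym (×-homo-+ 1# a b)) (reflexive (≡.cong (_⋆ 1#) (≡.sym 2+m≡a+b)))))
          (solve 1 (λ k → # 1 :+ k :- # 1 := k) refl (suc m ⋆ 1#))))))
        (solve 3 (λ k d s → k :* d :- k :* s := k :* (d :- s)) refl (suc m ⋆ 1#) (d θ m) (x + y)))

  scaled-upper : ∀ {θ a x b y m} → FareyPair± θ a x b y → x >0 → y >0 → y ≤ x → 1 ℕ.≤ a →
                 a ℕ.+ b ℕ.≤ suc m → scaledGap θ m ≤ (suc m ⋆ 1#) * x
  scaled-upper {θ} {m = m} F x>0 y>0 y≤x 1≤a h = ≤-by
    (n≥0 (suc m) *₀ ≤⇒≥0 (gap-upper± em F x>0 y>0 ≤-refl y≤x (ℕ.≤-trans 1≤a (ℕ.m≤m+n _ _)) h))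
    (trans (+-congˡ (-‿cong (⋆-as-* (suc m) (d θ m))))
      (solve 3 (λ k x d → k :* x :- k :* d := k :* (x :- d)) refl (suc m ⋆ 1#) _ (d θ m)))

  -- While d stays at most x, only the factor m + 1 grows. The margin `j` = 1 covers the whole stage
  -- up to the next pair; `j` = 2 stops one index earlier, as `value-late` requires.
  scaled-between : ∀ j {θ a x b y m} → FareyPair± θ a x b y → x >0 → y >0 → y ≤ x → 1 ℕ.≤ a →
                   a ℕ.+ b ℕ.≤ suc m → j ℕ.+ suc m ℕ.≤ total (next (a , b)) →
                   scaledGap θ m ≤ (size (next (a , b)) - j ⋆ 1#) * x
  scaled-between j {a = a} {x = x} {b} {m = m} F x>0 y>0 y≤x 1≤a h h′ =
    ≤-trans (scaled-upper F x>0 y>0 y≤x 1≤a h) (≤-by (≤⇒≥0 (⋆-mono h′) *₀ inj₁ x>0)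
      (trans (solve 4 (λ s j k x → (s :- j) :* x :- k :* x := (s :- (j :+ k)) :* x) refl
          (size (next (a , b))) (j ⋆ 1#) (suc m ⋆ 1#) x)
        (*-congʳ (sym (+-cong (×-homo-+ 1# b (a ℕ.+ b)) (-‿cong (×-homo-+ 1# j (suc m))))))))

  AtMost : Carrier → Carrier → State → Set
  AtMost θ v s = ∀ m → 1 ℕ.≤ m → 2 ℕ.+ m ℕ.≤ total s → scaledGap θ m ≤ v

  ψX≤X : ∀ {X} → X >0 → ψ * X ≤ X
  ψX≤X {X} X>0 = ≤-by (inj₁ (X>0 *₊ 1-ψ>0)) (solve 1 (λ X → X :- ψ′ :* X := X :* (# 1 :- ψ′)) refl X)

  -- On the stage from s to next s the scaled gaps are at most the value of next s, and the values
  -- increase up to the last one, which is at most v.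
  atMost-next^ : ∀ k s {θ X v} → Golden θ s X → ∣ error s ∣≤1 → AllPositive s → AtMost θ v s →
                 value (next^ k s) (shrink k X) ≤ v → AtMost θ v (next^ k s)
  atMost-next^ zero    s g h p atMost _   = atMost
  atMost-next^ (suc k) s {θ} {X} {v} g h p atMost V≤v =
    atMost-next^ k (next s) (golden-next g) (small-next s h) (positive-next s p) atMost′ V≤v
    where
    atMost′ : AtMost θ v (next s)
    atMost′ m 1≤m 2+m≤ with 2 ℕ.+ m ℕ.≤? total s
    ... | yes 2+m≤total = atMost m 1≤m 2+m≤total
    ... | no  2+m≰total = ≤-trans
      (≤-trans (scaled-between 1 (pair g) (X>0 g) (ψ>0 *₊ X>0 g) (ψX≤X (X>0 g)) (proj₁ p)
          (ℕ.s≤s⁻¹ (ℕ.≰⇒> 2+m≰total)) 2+m≤)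
        (inj₂ (solve 2 (λ t X → (t :- (# 1 :+ # 0)) :* X := (t :- # 1) :* (ψ′ :* X :+ ψ′ :* (ψ′ :* X)))
          refl (size (next s)) X)))
      (≤-trans (value-next^ k (next s) (reciprocal-next s (reciprocal g)) (small-next s h)) V≤v)

  -- Three ranges: finitely many early indices lie strictly below c and are overtaken; the complete
  -- stages fall to `atMost-next^`; the last stage, cut one index short by 3 + m instead of 2 + m,
  -- falls to `value-late`.
  value-bounds : ∀ s {θ X} → Golden θ s X → ∣ error s ∣≤1 → AllPositive s →
                 (∀ m → 1 ℕ.≤ m → 2 ℕ.+ m ℕ.≤ total s → scaledGap θ m < c) →
                 Eventually (λ k → ∀ m → 1 ℕ.≤ m → 3 ℕ.+ m ℕ.≤ total (next (next^ k s)) →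
                   scaledGap θ m ≤ value (next^ k s) (shrink k X))
  value-bounds s {θ} {X} g h p early = eventually-map bound
    (eventually-All (All.universal eventually-early (upTo (total s))))
    where
    EarlyBelow : ℕ → ℕ → Set
    EarlyBelow m k = 1 ℕ.≤ m → 2 ℕ.+ m ℕ.≤ total s →
                     scaledGap θ m ≤ value (next^ k s) (shrink k X)

    eventually-early : ∀ m → Eventually (EarlyBelow m)
    eventually-early m with 1 ℕ.≤? m | 2 ℕ.+ m ℕ.≤? total s
    ... | yes 1≤m | yes 2+m≤ = eventually-map (λ _ q _ _ → q)
                                 (value-limit s (reciprocal g) h (early m 1≤m 2+m≤))
    ... | no 1≰m  | _        = 0 , λ _ _ 1≤m _ → contradiction 1≤m 1≰m
    ... | yes _   | no 2+m≰  = 0 , λ _ _ _ 2+m≤ → contradiction 2+m≤ 2+m≰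

    bound : ∀ k → All (λ m → EarlyBelow m k) (upTo (total s)) → ∀ m → 1 ℕ.≤ m →
            3 ℕ.+ m ℕ.≤ total (next (next^ k s)) → scaledGap θ m ≤ value (next^ k s) (shrink k X)
    bound k earlyBelow m 1≤m 3+m≤ with 2 ℕ.+ m ℕ.≤? total (next^ k s)
    ... | yes 2+m≤ = atMost-next^ k s g h p
          (λ i 1≤i 2+i≤ → All.lookup earlyBelow (∈-upTo⁺ (ℕ.≤-trans (ℕ.n≤1+n _) 2+i≤)) 1≤i 2+i≤)
          ≤-refl m 1≤m 2+m≤
    ... | no  2+m≰ = ≤-trans
      (scaled-between 2 (pair gₖ) (X>0 gₖ) (ψ>0 *₊ X>0 gₖ) (ψX≤X (X>0 gₖ))
        (proj₁ (positive-next^ k s p)) (ℕ.s≤s⁻¹ (ℕ.≰⇒> 2+m≰)) 3+m≤)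
      (value-late (next^ k s) (reciprocal gₖ) (small-next^ k s h))
      where
      gₖ = golden-next^ k g

  Beats : State → State → Set
  Beats t s′ = ∃[ j ] Overtakes t (next^ j s′) × 3 ℕ.≤ total (next^ j s′)

  beats : ∀ s s′ i j → ∣ error s ∣≤1 → ∣ error s′ ∣≤1 → AllPositive s′ →
          Interlaced (next^ i s) (next^ j s′) → Eventually (λ k → Beats (next^ k s) s′)
  beats s s′ i j h h′ p′ interlaced = eventually-shift i
    (eventually-map beat
      (eventually-×
        (overtakes (next^ i s) (next^ j s′) (small-next^ i s h) (small-next^ j s′ h′) interlaced)
                    (3 , λ _ q → q)))
    where
    beat : ∀ k → Overtakes (next^ k (next^ i s)) (next^ k (next^ j s′)) × 3 ℕ.≤ k →
           Beats (next^ (i ℕ.+ k) s) s′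
    beat k (o , 3≤k) = j ℕ.+ k ,
      ≡.subst₂ Overtakes (≡.sym (next^-+ i k s)) (≡.sym (next^-+ j k s′)) o ,
      ℕ.≤-trans 3≤k (ℕ.≤-trans (ℕ.m≤n+m k j) (ℕ.≤-trans (ℕ.m≤m+n (j ℕ.+ k) (total s′))
        (total-next^ (j ℕ.+ k) s′ p′)))

  open Data.List.Extrema totalOrder using (max≤v⁺; v≤max⁺)

  -- Up to M = total (next t) - 3 the maximum for θ is at most the value of t, whereas θ′ has
  -- already attained the larger value of t′ at the index total t′ - 2 ≤ M.
  D-< : ∀ t s′ {θ θ′ X X′ M} → Reciprocal t X → Golden θ′ s′ X′ →
        3 ℕ.+ M ≡ total (next t) → 1 ℕ.≤ M →
        (∀ m → 1 ℕ.≤ m → 3 ℕ.+ m ℕ.≤ total (next t) → scaledGap θ m ≤ value t X) →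
        Beats t s′ → D[≤ M ] θ < D[≤ M ] θ′
  D-< t s′ {θ} {θ′} {X} {X′} {M} r g′ 3+M≡ 1≤M bound (j , (size< , deficit<) , 3≤total) =
    ≤-<-trans
      (max≤v⁺ (below 1 ℕ.≤-refl 1≤M)
        (All.applyUpTo⁺₁ _ M λ {i} i<M → below (suc i) (ℕ.s≤s ℕ.z≤n) i<M))
      (<-≤-trans (value-< t t′ r (reciprocal gⱼ) deficit<)
        (≤-trans (scaled-lower (pair gⱼ) (inj₁ (X>0 gⱼ)) (inj₁ (ψ>0 *₊ X>0 gⱼ)) 3+m′≡)
          (v≤max⁺ _ _ (inj₂ (Any.applyUpTo⁺ (λ i → scaledGap θ′ (suc i)) {i = m′} ≤-refl m′<M)))))
    where
    t′ = next^ j s′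
    gⱼ = golden-next^ j g′
    -- List positions start at 0: position m′ holds the index m′ + 1 = total t′ - 2.
    m′ = proj₁ (ℕ.m≤n⇒∃[o]m+o≡n 3≤total)
    3+m′≡ : 3 ℕ.+ m′ ≡ total t′
    3+m′≡ = proj₂ (ℕ.m≤n⇒∃[o]m+o≡n 3≤total)

    below : ∀ m → 1 ℕ.≤ m → m ℕ.≤ M → scaledGap θ m ≤ value t X
    below m 1≤m m≤M = bound m 1≤m (ℕ.≤-trans (ℕ.+-monoʳ-≤ 3 m≤M) (ℕ.≤-reflexive 3+M≡))

    total< : total t′ ℕ.< total (next t)
    total< = ⋆-cancel-< (<-respˡ-≈ (sym (×-homo-+ 1# (proj₁ t′) (proj₂ t′)))
      (<-respʳ-≈ (sym (×-homo-+ 1# (proj₁ (next t)) (proj₂ (next t)))) size<))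

    m′<M : m′ ℕ.< M
    m′<M = ℕ.+-cancelˡ-< 3 m′ M (≡.subst₂ ℕ._<_ (≡.sym 3+m′≡) (≡.sym 3+M≡) total<)

  -- Soundness of the search and the golden tail.

  at : Form → Carrier → Carrier → Carrier
  at (α , β) x y = fromℤ α * x + fromℤ β * y

  at-slow : ∀ p x y → at p x y ≈ at (slow p) y (x - y)
  at-slow (α , β) x y = trans
    (solve 4 (λ α β x y → α :* x :+ β :* y := (α :+ β) :* y :+ α :* (x :- y))
      refl (fromℤ α) (fromℤ β) x y)
    (+-congʳ (*-congʳ (sym (fromℤ-+ α β))))

  at-fast : ∀ p x y → at p x y ≈ at (fast p) (x - y) y
  at-fast (α , β) x y = trans
    (solve 4 (λ α β x y → α :* x :+ β :* y := α :* (x :- y) :+ (α :+ β) :* y)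
      refl (fromℤ α) (fromℤ β) x y)
    (+-congˡ (*-congʳ (sym (fromℤ-+ α β))))

  fromℤ≥0 : ∀ {i} → ℤ.0ℤ ℤ.≤ i → fromℤ i ≥0
  fromℤ≥0 {+ n} _ = n≥0 n
  fromℤ≥0 { -[1+ n ]} ()

  refutes-sound : ∀ {x y} p q → y >0 → at p x y ≥0 → at q x y ≥0 → ¬ Refutes p q
  refutes-sound {x} {y} (α , β) (α′ , β′) y>0 p≥0 q≥0 (0≤α , α′≤0 , neg) =
    <⇒≱ (fromℤ>0 (ℤ.neg-mono-< neg) *₊ y>0)
      (≤-by (fromℤ≥0 0≤α *₀ q≥0 +₀ fromℤ≥0 (ℤ.neg-mono-≤ α′≤0) *₀ p≥0)
        (trans (+-congˡ (-‿cong (*-congʳ (trans (fromℤ-neg (α ℤ.* β′ ℤ.- α′ ℤ.* β)) (-‿cong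
            (trans (fromℤ-+ (α ℤ.* β′) (ℤ.- (α′ ℤ.* β))) (+-cong (fromℤ-* α β′)
              (trans (fromℤ-neg (α′ ℤ.* β)) (-‿cong (fromℤ-* α′ β))))))))))
          (trans (solve 6 (λ α β α′ β′ x y → # 0 :- :- (α :* β′ :- α′ :* β) :* y :=
              α :* (α′ :* x :+ β′ :* y) :+ :- α′ :* (α :* x :+ β :* y)) refl
              (fromℤ α) (fromℤ β) (fromℤ α′) (fromℤ β′) x y)
            (+-congˡ (*-congʳ (sym (fromℤ-neg α′)))))))

  inconsistent-sound : ∀ {x y Γ} → y >0 → All (λ p → at p x y ≥0) Γ → ¬ Inconsistent Γ
  inconsistent-sound y>0 holds i with p≥0 , j ← All.lookupAny holds i
                               with q≥0 , r ← All.lookupAny holds j =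
    refutes-sound _ _ y>0 p≥0 q≥0 r

  Bounded : Carrier → Set
  Bounded θ = ∀ m → 1 ℕ.≤ m → scaledGap θ m ≤ c

  record Realises (θ x₀ : Carrier) (n : Node) : Set where
    open Node n
    field
      {x y}     : Carrier
      pair±     : FareyPair± θ (proj₁ denominators) x (proj₂ denominators) y
      y≤x       : y ≤ x
      y>0       : y >0
      allPositive : AllPositive denominators
      early     : ∀ m → 1 ℕ.≤ m → 2 ℕ.+ m ℕ.≤ total denominators →
                  Any (λ p → scaledGap θ m ≤ at p x y) values
      holds     : All (λ p → at p x y ≥0) constraints
      origin≈   : x₀ ≈ at origin x y

    x>0 : x >0
    x>0 = <-≤-trans y>0 y≤x

  -- 3 ≤ a + b makes the index a + b - 2 of `scaled-lower` at least 1, where `Bounded` starts.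
  pair-bound : ∀ {θ a x b y} → Bounded θ → FareyPair± θ a x b y → x ≥0 → y ≥0 →
               3 ℕ.≤ a ℕ.+ b → (a ⋆ 1# + b ⋆ 1# - 1#) * (x + y) ≤ c
  pair-bound bounded F x≥0 y≥0 3≤a+b =
    let (o , 3+o≡a+b) = ℕ.m≤n⇒∃[o]m+o≡n 3≤a+b
    in ≤-trans (scaled-lower F x≥0 y≥0 3+o≡a+b) (bounded (suc o) (ℕ.s≤s ℕ.z≤n))

  3-c>0 : fromℤ (+ 3) - c >0
  3-c>0 = <⇒>0 (*-cancelˡ-< (1+n>0 4) (<-by (literal>0 (+ 8 , -[1+ 3 ]))
    (trans (+-congˡ (-‿cong 5c≈7+4ψ))
      (solve 0 (# 5 :* # 3 :- (# 7 :+ # 4 :* ψ′) := con (+ 8 , -[1+ 3 ])) refl))))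

  c-1>0 : c - 1# >0
  c-1>0 = <⇒>0 (*-cancelˡ-< (1+n>0 4) (<-by (literal>0 (+ 2 , + 4))
    (trans (+-congʳ 5c≈7+4ψ)
      (solve 0 (# 7 :+ # 4 :* ψ′ :- # 5 :* # 1 := con (+ 2 , + 4)) refl))))

  -- The rational ceiling that turns the bound by c into integer forms; it exceeds c by less than
  -- 1/10000.
  c<3789/2000 : fromℤ (+ 3789) - fromℤ (+ 2000) * c >0
  c<3789/2000 = <⇒>0 (*-cancelˡ-< (1+n>0 4) (<-by (literal>0 (+ 4945 , -[1+ 7999 ]))
    (trans (solve 1 (λ c →
        # 5 :* # 3789 :- # 5 :* (# 2000 :* c) := # 18945 :- # 2000 :* (# 5 :* c)) refl c)
      (trans (+-congˡ (-‿cong (*-congˡ 5c≈7+4ψ)))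
        (solve 0 (# 18945 :- # 2000 :* (# 7 :+ # 4 :* ψ′) := con (+ 4945 , -[1+ 7999 ])) refl)))))

  -- If y were 0, then θ would be rational with denominator b, and the gap of length
  -- x = 1/b would persist.
  length>0 : ∀ {θ a x b y} → Bounded θ → FareyPair± θ a x b y → x ≥0 → y ≥0 →
             1 ℕ.≤ a → 1 ℕ.≤ b → y >0
  length>0 _ _ _ (inj₁ y>0) _ _ = y>0
  length>0 {θ} {a} {x} {b} {y} bounded F x≥0 (inj₂ 0≈y) 1≤a 1≤b = contradiction
    -- With y = 0 two steps leave x unchanged, and b x = 1 gives (a + 3 b - 1) x = 3 + (a - 1) x ≥ 3
    -- > c.
    (pair-bound bounded (step (step F)) (≥0-resp x≈ x≥0) (inj₂ 0≈y)
      (ℕ.≤-trans (ℕ.+-mono-≤ (ℕ.+-mono-≤ 1≤a 1≤b) 1≤b) (ℕ.m≤m+n (a ℕ.+ b ℕ.+ b) b)))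
    (<⇒≱ (<-by (3-c>0 +₊ ≤⇒≥0 (⋆-mono 1≤a) *₀ x≥0)
      (trans (+-congʳ (*-congʳ (+-congʳ (+-congʳ
        (trans (×-homo-+ 1# (a ℕ.+ b) b) (+-congʳ (×-homo-+ 1# a b)))))))
      (trans (solve 5 (λ A B x y c → (A :+ B :+ B :+ B :- # 1) :* (x :- y :- y :+ y) :- c :=
          # 3 :* (A :* y :+ B :* x) :- c :+ (A :- (# 1 :+ # 0)) :* x
            :- (# 4 :* A :+ # 3 :* B :- # 1) :* y) refl (a ⋆ 1#) (b ⋆ 1#) x y c)
      (trans (+-cong (+-congʳ (+-congʳ (trans (*-congˡ (determinant± F)) (*-identityʳ _))))
                     (-‿cong (trans (*-congˡ (sym 0≈y)) (zeroʳ _))))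
        (solve 1 (λ e → e :- # 0 := e) refl _))))))
    where
    x≈ : x ≈ x - y - y
    x≈ = trans (solve 1 (λ x → x := x :- # 0 :- # 0) refl x)
      (+-cong (+-congˡ (-‿cong 0≈y)) (-‿cong 0≈y))

  -- The next pair has denominators a + b and b and length sum x, so (a + 2 b - 1) x ≤ c. On the
  -- other hand 2 y ≤ x gives 2 = 2 (a y + b x) ≤ (a + 2 b) x.
  double : ∀ {θ a x b y} → Bounded θ → FareyPair± θ a x b y → 1 ℕ.≤ a → 1 ℕ.≤ b →
           y ≥0 → y ≤ x - y → fromℤ (+ 2) - c ≤ x
  double {θ} {a} {x} {b} {y} bounded F 1≤a 1≤b y≥0 y≤x-y = ≤-by
    (≤⇒≥0 (pair-bound bounded (step F) (≤-trans y≥0 y≤x-y) y≥0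
        (ℕ.+-mono-≤ (ℕ.+-mono-≤ 1≤a 1≤b) 1≤b)) +₀ n≥0 a *₀ ≤⇒≥0 y≤x-y)
    (trans (solve 2 (λ x c → x :- (# 2 :- c) := c :- # 2 :* # 1 :+ x) refl x c)
      (trans (+-congʳ (+-congˡ (-‿cong (*-congˡ (sym (determinant± F))))))
        (trans (solve 5 (λ A B x y c → c :- # 2 :* (A :* y :+ B :* x) :+ x :=
            c :- (A :+ B :+ B :- # 1) :* (x :- y :+ y) :+ A :* (x :- y :- y)) refl
            (a ⋆ 1#) (b ⋆ 1#) x y c)
          (+-congʳ (+-congˡ (-‿cong (*-congʳ (+-congʳ (+-congʳ (sym (×-homo-+ 1# a b)))))))))))

  -- Passing from (x , y) to (y , x - y) multiplies y - ψ x by - φ.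
  small-ratio : ∀ k {θ a x b y} → Bounded θ → FareyPair± θ a x b y → 1 ℕ.≤ a → 1 ℕ.≤ b →
                y ≥0 → y ≤ x → x < fromℤ (+ 2) - c → ∣ φ^ k * (y - ψ * x) ∣≤1
  small-ratio zero {x = x} {y = y} bounded F 1≤a 1≤b y≥0 y≤x x< =
    ≥0-resp (solve 2 (λ x y → # 1 :- x :+ (x :- y) :+ ψ′ :* x := # 1 :- # 1 :* (y :- ψ′ :* x))
      refl x y)
      (1-x≥0 +₀ ≤⇒≥0 y≤x +₀ inj₁ ψ>0 *₀ x≥0) ,
    ≥0-resp (solve 2 (λ x y → y :+ (# 1 :- ψ′) :+ ψ′ :* (# 1 :- x) := # 1 :+ # 1 :* (y :- ψ′ :* x))
      refl x y)
      (y≥0 +₀ inj₁ 1-ψ>0 +₀ inj₁ ψ>0 *₀ 1-x≥0)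
    where
    x≥0 = ≤-trans y≥0 y≤x
    1-x≥0 : 1# - x ≥0
    1-x≥0 = ≥0-resp (solve 2 (λ x c → # 2 :- c :- x :+ (c :- # 1) := # 1 :- x) refl x c)
      (inj₁ (<⇒>0 x<) +₀ inj₁ c-1>0)
  small-ratio (suc k) {a = a} {x} {b} {y} bounded F 1≤a 1≤b y≥0 y≤x x< with ≤∨> (x - y) y
  ... | inj₂ y<x-y = contradiction (double bounded F 1≤a 1≤b y≥0 (inj₁ y<x-y)) (<⇒≱ x<)
  ... | inj₁ x-y≤y = ∣∣≤1-resp
    (solve 3 (λ p x y → :- (p :* (x :- y :- ψ′ :* y)) := p :* (# 1 :+ ψ′) :* (y :- ψ′ :* x))
      refl (φ^ k) x y)
    (∣-∣≤1 (small-ratio k bounded (swap (step F)) 1≤b (ℕ.≤-trans 1≤a (ℕ.m≤m+n a b))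
      (≤⇒≥0 y≤x) x-y≤y (≤-<-trans y≤x x<)))

  ratio-golden : ∀ {θ a x b y} → Bounded θ → FareyPair± θ a x b y → 1 ℕ.≤ a → 1 ℕ.≤ b →
                 y ≥0 → y ≤ x → x < fromℤ (+ 2) - c → y ≈ ψ * x
  ratio-golden {x = x} {y = y} bounded F 1≤a 1≤b y≥0 y≤x x< =
    ≤-antisym (≮⇒≥ λ ψx<y → unbounded (<⇒>0 ψx<y) λ k → proj₁ (ratio k))
              (≮⇒≥ λ y<ψx → unbounded (<⇒>0 y<ψx) λ k → ≥0-resp
                (solve 3 (λ p x y → # 1 :+ p :* (y :- ψ′ :* x) := # 1 :- p :* (ψ′ :* x :- y))
                  refl (φ^ k) x y)
                (proj₂ (ratio k)))
    where
    ratio = λ k → small-ratio k bounded F 1≤a 1≤b y≥0 y≤x x<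
    unbounded : ∀ {e} → e >0 → ¬ (∀ k → 1# - φ^ k * e ≥0)
    unbounded {e} e>0 h = let (k , p) = growth 1# e>0 in
      <⇒≱ (p k ℕ.≤-refl) (≤-by (h k) refl)

  fromℤ-size : ∀ a b → fromℤ (+ a ℤ.+ + b ℤ.- ℤ.1ℤ) ≈ a ⋆ 1# + b ⋆ 1# - 1#
  fromℤ-size a b = trans (fromℤ-+ (+ (a ℕ.+ b)) ℤ.-1ℤ)
    (+-cong (×-homo-+ 1# a b) (-‿cong (+-identityʳ 1#)))

  valueBound-sound : ∀ {θ a x b y} → Bounded θ → FareyPair± θ a x b y → x ≥0 → y ≥0 →
                     3 ℕ.≤ a ℕ.+ b → at (valueBound (a , b)) x y ≥0
  valueBound-sound {a = a} {x} {b} {y} bounded F x≥0 y≥0 3≤ = ≥0-resp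
    (trans (solve 3 (λ c v o →
          # 3789 :- # 2000 :* c :+ # 2000 :* (c :- v) := # 3789 :* # 1 :- # 2000 :* v) refl
        c ((a ⋆ 1# + b ⋆ 1# - 1#) * (x + y)) 1#)
      (trans (+-congʳ (*-congˡ (sym (determinant± F))))
        (trans (solve 5 (λ A B k x y → # 3789 :* (A :* y :+ B :* x) :- # 2000 :* (k :* (x :+ y)) :=
            (# 3789 :* B :- # 2000 :* k) :* x :+ (# 3789 :* A :- # 2000 :* k) :* y) refl
            (a ⋆ 1#) (b ⋆ 1#) (a ⋆ 1# + b ⋆ 1# - 1#) x y)
          (+-cong (*-congʳ (sym (coefficient b))) (*-congʳ (sym (coefficient a)))))))
    (inj₁ c<3789/2000 +₀ n≥0 2000 *₀ ≤⇒≥0 (pair-bound bounded F x≥0 y≥0 3≤))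
    where
    k = + a ℤ.+ + b ℤ.- ℤ.1ℤ
    coefficient : ∀ j → fromℤ (+ 3789 ℤ.* + j ℤ.- + 2000 ℤ.* k) ≈
                  fromℤ (+ 3789) * j ⋆ 1# - fromℤ (+ 2000) * (a ⋆ 1# + b ⋆ 1# - 1#)
    coefficient j = trans (fromℤ-+ (+ 3789 ℤ.* + j) (ℤ.- (+ 2000 ℤ.* k)))
      (+-cong (fromℤ-* (+ 3789) (+ j)) (trans (fromℤ-neg (+ 2000 ℤ.* k))
        (-‿cong (trans (fromℤ-* (+ 2000) k) (*-congˡ (fromℤ-size a b))))))

  extend-sound : ∀ {θ x₀ n} (R : Realises θ x₀ n) → Bounded θ → ∀ σ {a x′ b y′} →
    FareyPair± θ a x′ b y′ → x′ + y′ ≈ Realises.x R →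
    a ℕ.+ b ≡ total (next (Node.denominators n)) →
    (∀ p → at p (Realises.x R) (Realises.y R) ≈ at (σ p) x′ y′) →
    y′ ≤ x′ → y′ >0 → AllPositive (a , b) → Realises θ x₀ (extend σ n (a , b))
  extend-sound {θ} {x₀} {n} R bounded σ {a} {x′} {b} {y′} F sum total≡ σ≈ y′≤x′ y′>0 pos = record
    { pair± = F ; y≤x = y′≤x′ ; y>0 = y′>0 ; allPositive = pos ; early = early′
    ; holds = ≥0-resp
        (solve 2 (λ x y → x :- y := (# 1 :+ # 0) :* x :+ :- (# 1 :+ # 0) :* y) refl x′ y′) (≤⇒≥0 y′≤x′)
        ∷ valueBound-sound bounded F (inj₁ (<-≤-trans y′>0 y′≤x′)) (inj₁ y′>0) 3≤
        ∷ All.map⁺ (All.map (λ {p} → ≥0-resp (σ≈ p)) holds)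
    ; origin≈ = trans origin≈ (σ≈ (Node.origin n))
    }
    where
    open Realises R
    s = Node.denominators n

    3≤ : 3 ℕ.≤ a ℕ.+ b
    3≤ = ≡.subst (3 ℕ.≤_) (≡.sym total≡)
      (ℕ.+-mono-≤ (proj₂ allPositive) (ℕ.+-mono-≤ (proj₁ allPositive) (proj₂ allPositive)))

    early′ : ∀ m → 1 ℕ.≤ m → 2 ℕ.+ m ℕ.≤ a ℕ.+ b →
             Any (λ p → scaledGap θ m ≤ at p x′ y′) (Node.values (extend σ n (a , b)))
    early′ m 1≤m 2+m≤ with 2 ℕ.+ m ℕ.≤? total s
    ... | yes 2+m≤s = there (Any.map⁺ (Any.map (λ {p} h → ≤-trans h (inj₂ (σ≈ p))) (early m 1≤m 2+m≤s)))
    -- On the new stage d is at most the old x, which is x′ + y′ in the new lengths.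
    ... | no  2+m≰s = here (≤-trans
      (scaled-between 1 pair± x>0 y>0 y≤x (proj₁ allPositive) (ℕ.s≤s⁻¹ (ℕ.≰⇒> 2+m≰s))
        (≡.subst (2 ℕ.+ m ℕ.≤_) total≡ 2+m≤))
      (inj₂ (trans (*-cong (+-cong sizes (-‿cong (+-identityʳ 1#))) (sym sum))
        (trans (*-congʳ (sym (fromℤ-size a b))) (distribˡ _ x′ y′)))))
      where
      sizes : size (next s) ≈ a ⋆ 1# + b ⋆ 1#
      sizes = trans (sym (×-homo-+ 1# (proj₁ (next s)) (proj₂ (next s))))
        (trans (reflexive (≡.cong (_⋆ 1#) (≡.sym total≡))) (×-homo-+ 1# a b))

  prune-sound : ∀ {P : Node → Set} n {ns} → ¬ Inconsistent (Node.constraints n) →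
                Any P ns → Any P (prune n ns)
  prune-sound n consistent found with inconsistent? (Node.constraints n)
  ... | yes i = contradiction i consistent
  ... | no _  = found

  search-sound : ∀ k {θ x₀ n} → Bounded θ → Realises θ x₀ n → Any (Realises θ x₀) (search k n)
  search-sound zero    bounded R = here R
  search-sound (suc k) {θ} {x₀} {n} bounded R = branch (≤∨> (x - y) y)
    where
    open Realises R
    s = Node.denominators n
    a = proj₁ s
    b = proj₂ s

    positive-sum : 1 ℕ.≤ a ℕ.+ b
    positive-sum = ℕ.≤-trans (proj₁ allPositive) (ℕ.m≤m+n a b)

    -- Equality would make θ rational. Strictness matters because `Refutes` contradicts only a
    -- positive y.
    x-y>0 : x - y >0
    x-y>0 = length>0 bounded (swap (step pair±)) (inj₁ y>0) (≤⇒≥0 y≤x) (proj₂ allPositive) positive-sum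

    consistent : ∀ {m} → Realises θ x₀ m → ¬ Inconsistent (Node.constraints m)
    consistent R′ = inconsistent-sound (Realises.y>0 R′) (Realises.holds R′)

    branch : x - y ≤ y ⊎ y < x - y → Any (Realises θ x₀) (search (suc k) n)
    branch (inj₁ x-y≤y) =
      Any.++⁺ˡ (prune-sound (slowChild n) (consistent R′) (search-sound k bounded R′))
      where
      R′ : Realises θ x₀ (slowChild n)
      R′ = extend-sound R bounded slow (swap (step pair±))
        (solve 2 (λ x y → y :+ (x :- y) := x) refl x y) ≡.refl (λ p → at-slow p x y)
        x-y≤y x-y>0 (proj₂ allPositive , positive-sum)
    branch (inj₂ y<x-y) = Any.++⁺ʳ (prune (slowChild n) (search k (slowChild n)))
      (prune-sound (fastChild n) (consistent R′) (search-sound k bounded R′))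
      where
      R′ : Realises θ x₀ (fastChild n)
      R′ = extend-sound R bounded fast (step pair±)
        (solve 2 (λ x y → x :- y :+ y := x) refl x y) (ℕ.+-comm (a ℕ.+ b) b) (λ p → at-fast p x y)
        (inj₁ y<x-y) y>0 (positive-sum , proj₂ allPositive)

  floor : ∀ θ → ∃[ n ] fromℤ n ≤ θ × θ < fromℤ n + 1#
  floor θ =
    let (j , -θ<j) = archimedean em (- θ)
        (k , θ+j<k) = archimedean em (θ + j ⋆ 1#)
    in climb k (ℤ.- + j)
      (≤-resp (sym (fromℤ-neg (+ j))) refl
        (inj₁ (<-by (<⇒>0 -θ<j) (solve 2 (λ t j → t :- :- j := j :- :- t) refl θ (j ⋆ 1#)))))
      (<-respʳ-≈ (+-congʳ (sym (fromℤ-neg (+ j))))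
        (<-by (<⇒>0 θ+j<k)
          (solve 3 (λ t j k → :- j :+ k :- t := k :- (t :+ j)) refl θ (j ⋆ 1#) (k ⋆ 1#))))
    where
    climb : ∀ k n → fromℤ n ≤ θ → θ < fromℤ n + k ⋆ 1# → ∃[ n ] fromℤ n ≤ θ × θ < fromℤ n + 1#
    climb zero    n n≤θ θ< = contradiction n≤θ (<⇒≱ (<-respʳ-≈ (+-identityʳ _) θ<))
    climb (suc k) n n≤θ θ< with ≤∨> (fromℤ n + 1#) θ
    ... | inj₂ θ<n+1 = n , n≤θ , θ<n+1
    ... | inj₁ n+1≤θ = climb k (n ℤ.+ ℤ.1ℤ) (≤-resp (sym n+1≈) refl n+1≤θ)
      (<-respʳ-≈ (trans (sym (+-assoc _ _ _)) (+-congʳ (sym n+1≈))) θ<)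
      where
      n+1≈ : fromℤ (n ℤ.+ ℤ.1ℤ) ≈ fromℤ n + 1#
      n+1≈ = trans (fromℤ-+ n ℤ.1ℤ) (+-congˡ (+-identityʳ 1#))

  SameDistance : Carrier → Carrier → Set
  SameDistance θ x₀ = IsInteger (θ - x₀) ⊎ IsInteger (θ + x₀)

  -- Consecutive integers around θ form a pair with denominators 1 and 1. The distance to the nearer
  -- one becomes the shorter length, and `FareyPair±` absorbs the side on which it lies.
  initial-pair : ∀ θ → ∃[ x₀ ] SameDistance θ x₀ × x₀ ≥0 × x₀ ≤ 1# - x₀ × FareyPair± θ 1 (1# - x₀) 1 x₀
  initial-pair θ = let (n , n≤θ , θ<n+1) = floor θ in from-floor n n≤θ θ<n+1
   where
   from-floor : ∀ n → fromℤ n ≤ θ → θ < fromℤ n + 1# →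
     ∃[ x₀ ] SameDistance θ x₀ × x₀ ≥0 × x₀ ≤ 1# - x₀ × FareyPair± θ 1 (1# - x₀) 1 x₀
   from-floor n n≤θ θ<n+1 = orient (≤∨> u (1# - u))
    where
    u = θ - fromℤ n

    pair₀ : FareyPair θ 1 u 1 (1# - u)
    pair₀ = fareyPair n (n ℤ.+ ℤ.1ℤ)
      (solve 2 (λ t n → t :- n := (# 1 :+ # 0) :* t :- n) refl θ (fromℤ n))
      (trans (solve 2 (λ t n → # 1 :- (t :- n) := n :+ (# 1 :+ # 0) :- (# 1 :+ # 0) :* t)
          refl θ (fromℤ n))
        (+-congʳ (sym (fromℤ-+ n ℤ.1ℤ))))
      (identity n)
      where
      identity : ∀ n → ℤ.1ℤ ℤ.* (n ℤ.+ ℤ.1ℤ) ℤ.- n ℤ.* ℤ.1ℤ ≡ ℤ.1ℤ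
      identity = solve-∀

    orient : u ≤ 1# - u ⊎ 1# - u < u →
             ∃[ x₀ ] SameDistance θ x₀ × x₀ ≥0 × x₀ ≤ 1# - x₀ × FareyPair± θ 1 (1# - x₀) 1 x₀
    orient (inj₁ u≤1-u) = u , inj₁ (n , solve 2 (λ t n → t :- (t :- n) := n) refl θ (fromℤ n)) ,
      ≤⇒≥0 n≤θ , u≤1-u , inj₂ pair₀
    orient (inj₂ 1-u<u) = 1# - u ,
      inj₂ (n ℤ.+ ℤ.1ℤ , trans
        (solve 2 (λ t n → t :+ (# 1 :- (t :- n)) := n :+ (# 1 :+ # 0)) refl θ (fromℤ n))
        (sym (fromℤ-+ n ℤ.1ℤ))) ,
      inj₁ (<-respʳ-≈ (solve 2 (λ t n → n :+ # 1 :- t := # 1 :- (t :- n)) refl θ (fromℤ n))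
        (<⇒>0 θ<n+1)) ,
      inj₁ (<-respʳ-≈ u≈ 1-u<u) , FareyPair±-resp u≈ refl (inj₁ pair₀)
      where
      u≈ : u ≈ 1# - (1# - u)
      u≈ = solve 1 (λ u → u := # 1 :- (# 1 :- u)) refl u

  realises-root : ∀ {θ x₀} → Bounded θ → x₀ ≥0 → x₀ ≤ 1# - x₀ → FareyPair± θ 1 (1# - x₀) 1 x₀ →
                  Realises θ x₀ root
  realises-root {x₀ = x₀} bounded x₀≥0 x₀≤ F = record
    { pair± = F ; y≤x = x₀≤ ; y>0 = length>0 bounded F (≤-trans x₀≥0 x₀≤) x₀≥0 ℕ.≤-refl ℕ.≤-refl
    ; allPositive = ℕ.≤-refl , ℕ.≤-refl
    ; early = λ m 1≤m 2+m≤2 →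
        contradiction (ℕ.≤-trans (ℕ.+-monoʳ-≤ 2 1≤m) 2+m≤2) λ { (ℕ.s≤s (ℕ.s≤s ())) }
    ; holds = []
    ; origin≈ = solve 1 (λ x → x := # 0 :* (# 1 :- x) :+ (# 1 :+ # 0) :* x) refl x₀
    }

  record Profile (θ x₀ : Carrier) (n : Node) : Set where
    constructor profile
    open Node n
    field
      {X}       : Carrier
      isGolden  : Golden θ denominators X
      early     : ∀ m → 1 ℕ.≤ m → 2 ℕ.+ m ℕ.≤ total denominators → scaledGap θ m < c
      origin≈   : x₀ ≈ at origin X (ψ * X)

  small-error : ∀ s → SmallError s → ∣ error s ∣≤1
  small-error (a , b) (p , q) =
    inj₁ (<-respʳ-≈ (trans (⟦⟧-expand (ℤ.1ℤ ℤ.- (+ b ℤ.- + a)) (+ a))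
      (trans (+-congʳ (trans (fromℤ-+ ℤ.1ℤ (ℤ.- (+ b ℤ.- + a)))
          (+-congˡ (trans (fromℤ-neg (+ b ℤ.- + a)) (-‿cong b-a)))))
        (solve 2 (λ A B → # 1 :+ # 0 :- (B :- A) :+ A :* ψ′ := # 1 :- (B :- A :* (# 1 :+ ψ′)))
          refl (a ⋆ 1#) (b ⋆ 1#))))
      (⟦⟧>0 (ℤ.1ℤ ℤ.- (+ b ℤ.- + a) , + a) p)) ,
    inj₁ (<-respʳ-≈ (trans (⟦⟧-expand (ℤ.1ℤ ℤ.+ (+ b ℤ.- + a)) (ℤ.- + a))
      (trans (+-cong (trans (fromℤ-+ ℤ.1ℤ (+ b ℤ.- + a)) (+-congˡ b-a)) (*-congʳ (fromℤ-neg (+ a))))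
        (solve 2 (λ A B → # 1 :+ # 0 :+ (B :- A) :+ :- A :* ψ′ := # 1 :+ (B :- A :* (# 1 :+ ψ′)))
          refl (a ⋆ 1#) (b ⋆ 1#))))
      (⟦⟧>0 (ℤ.1ℤ ℤ.+ (+ b ℤ.- + a) , ℤ.- + a) q))
    where
    b-a : fromℤ (+ b ℤ.- + a) ≈ b ⋆ 1# - a ⋆ 1#
    b-a = trans (fromℤ-+ (+ b) (ℤ.- + a)) (+-congˡ (fromℤ-neg (+ a)))

  ⟦⟧-sub : ∀ p q → ⟦ p ℤ[ψ]- q ⟧ψ ≈ ⟦ p ⟧ψ - ⟦ q ⟧ψ
  ⟦⟧-sub p q = trans (⟦⟧-+ p (ℤ[ψ].- q)) (+-congˡ (⟦⟧-neg q))

  weight≈ : ∀ s → ⟦ weightForm s ⟧ψ ≈ weight s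
  weight≈ (a , b) = ⟦⟧-expand (+ b) (+ a)

  at-golden : ∀ p X → at p X (ψ * X) ≈ ⟦ p ⟧ψ * X
  at-golden (α , β) X = trans
    (solve 3 (λ α β X → α :* X :+ β :* (ψ′ :* X) := (α :+ β :* ψ′) :* X) refl (fromℤ α) (fromℤ β) X)
    (*-congʳ (sym (⟦⟧-expand α β)))

  below-c : ∀ s {X} p → Reciprocal s X → BelowC s p → at p X (ψ * X) < c
  below-c s {X} p (X>0 , Xw≈1) below = <-respˡ-≈ (sym (at-golden p X)) (*-cancelˡ-< (1+n>0 4)
    (<-by (X>0 *₊ ⟦⟧>0 ((+ 7 , + 4) ℤ[ψ].* weightForm s ℤ[ψ]- (+ 5 , + 0) ℤ[ψ].* p) below) (trans
      (+-congʳ (trans 5c≈7+4ψ (trans (sym (*-identityʳ _)) (*-congˡ (sym Xw≈1)))))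
      (trans (solve 3 (λ X w p → con (+ 7 , + 4) :* (X :* w) :- # 5 :* (p :* X) :=
          X :* (con (+ 7 , + 4) :* w :- # 5 :* p)) refl X (weight s) ⟦ p ⟧ψ)
        (*-congˡ (sym (trans (⟦⟧-sub ((+ 7 , + 4) ℤ[ψ].* weightForm s) ((+ 5 , + 0) ℤ[ψ].* p))
          (+-cong (trans (⟦⟧-* (+ 7 , + 4) (weightForm s)) (*-congˡ (weight≈ s)))
                  (-‿cong (⟦⟧-* (+ 5 , + 0) p))))))))))

  -- The two roundings match: 211/2000 = 2 - 3789/2000 < 2 - c, so x ≥ 2 - c would make `notSmall`
  -- nonnegative.
  small-length : ∀ {θ a x b y} → FareyPair± θ a x b y → ¬ (at (notSmall (a , b)) x y ≥0) →
                 x < fromℤ (+ 2) - c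
  small-length {a = a} {x} {b} {y} F ¬≥0 with ≤∨> (fromℤ (+ 2) - c) x
  ... | inj₂ x< = x<
  ... | inj₁ ≤x = contradiction (≥0-resp
    (trans (solve 3 (λ x c o →
          # 3789 :- # 2000 :* c :+ # 2000 :* (x :- (# 2 :- c)) := # 2000 :* x :- # 211 :* # 1) refl
        x c 1#)
      (trans (+-congˡ (-‿cong (*-congˡ (sym (determinant± F)))))
        (trans (solve 4 (λ A B x y → # 2000 :* x :- # 211 :* (A :* y :+ B :* x) :=
            (# 2000 :- # 211 :* B) :* x :+ :- (# 211 :* A) :* y) refl (a ⋆ 1#) (b ⋆ 1#) x y)
          (sym (+-cong
            (*-congʳ (trans (fromℤ-+ (+ 2000) (ℤ.- (+ 211 ℤ.* + b)))
              (+-congˡ (trans (fromℤ-neg (+ 211 ℤ.* + b)) (-‿cong (fromℤ-* (+ 211) (+ b)))))))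
            (*-congʳ (trans (fromℤ-neg (+ 211 ℤ.* + a)) (-‿cong (fromℤ-* (+ 211) (+ a))))))))))
    (inj₁ c<3789/2000 +₀ n≥0 2000 *₀ ≤⇒≥0 ≤x)) ¬≥0

  leaf-profile : ∀ {θ x₀} n → Bounded θ → GoldenLeaf n → Realises θ x₀ n → Profile θ x₀ n
  leaf-profile {θ} (node s o vs Γ) bounded (_ , small , _ , below) R = profile g
    (λ m 1≤m 2+m≤ → strict below (early m 1≤m 2+m≤))
    (trans origin≈ (at-cong o))
    where
    open Realises R
    y≈ψx : y ≈ ψ * x
    y≈ψx = ratio-golden bounded pair± (proj₁ allPositive) (proj₂ allPositive) (inj₁ y>0) y≤x
      (small-length pair± λ h → inconsistent-sound y>0 (h ∷ holds) small)
    g : Golden θ s x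
    g = golden (FareyPair±-resp refl y≈ψx pair±) x>0
    at-cong : ∀ p → at p x y ≈ at p x (ψ * x)
    at-cong p = +-congˡ (*-congˡ y≈ψx)
    strict : ∀ {ps v} → All (BelowC s) ps → Any (λ p → v ≤ at p x y) ps → v < c
    strict {p ∷ _} (b ∷ _)  (here h)  =
      ≤-<-trans (≤-trans h (inj₂ (at-cong p))) (below-c s p (reciprocal g) b)
    strict         (_ ∷ bs) (there h) = strict bs h

  classify : ∀ {θ} → Bounded θ → ∃[ x₀ ] SameDistance θ x₀ × Any (Profile θ x₀) leaves
  classify {θ} bounded =
    let (x₀ , same , x₀≥0 , x₀≤ , F) = initial-pair θ
    in x₀ , same , combine leaves-golden (search-sound 9 bounded (realises-root bounded x₀≥0 x₀≤ F))
    where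
    combine : ∀ {x₀ ns} → All GoldenLeaf ns → Any (Realises θ x₀) ns → Any (Profile θ x₀) ns
    combine (l ∷ ls) (here R)  = here (leaf-profile _ bounded l R)
    combine (l ∷ ls) (there R) = there (combine ls R)

  open Profile

  -- The denominators fix X = 1/weight, and the origin form then fixes x₀; so a key determines θ up
  -- to sign and integers.
  same-leaf : ∀ {θ θ′ x₀ x₀′ n n′} → key n ≡ key n′ → Profile θ x₀ n → Profile θ′ x₀′ n′ → x₀ ≈ x₀′
  same-leaf {n = node s o _ _} {node _ _ _ _} ≡.refl P P′ =
    trans (origin≈ P) (trans (+-cong (*-congˡ X≈X′) (*-congˡ (*-congˡ X≈X′))) (sym (origin≈ P′)))
    where
    X≈X′ : X P ≈ X P′
    X≈X′ = trans (sym (*-identityʳ (X P)))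
      (trans (*-congˡ (sym (proj₂ (reciprocal (isGolden P′)))))
      (trans (solve 3 (λ x y w → x :* (y :* w) := y :* (x :* w)) refl (X P) (X P′) (weight s))
      (trans (*-congˡ (proj₂ (reciprocal (isGolden P)))) (*-identityʳ (X P′)))))

  integer-+ : ∀ {x y z} → x + y ≈ z → IsInteger x → IsInteger y → IsInteger z
  integer-+ eq (i , x≈i) (j , y≈j) =
    i ℤ.+ j , trans (sym eq) (trans (+-cong x≈i y≈j) (sym (fromℤ-+ i j)))

  integer-- : ∀ {x y z} → x - y ≈ z → IsInteger x → IsInteger y → IsInteger z
  integer-- eq p (j , y≈j) = integer-+ eq p (ℤ.- j , trans (-‿cong y≈j) (sym (fromℤ-neg j)))

  sameDistance⇒integer : ∀ {θ θ₀ x₀ x₀′} → x₀ ≈ x₀′ → SameDistance θ₀ x₀ → SameDistance θ x₀′ →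
                         IsInteger (θ - θ₀) ⊎ IsInteger (θ + θ₀)
  sameDistance⇒integer {θ} {θ₀} {x} {x′} x≈x′ = λ where
      (inj₁ p) (inj₁ q) → inj₁ (integer-- (trans
        (solve 4 (λ t s x y → t :- y :- (s :- x) := t :- s :+ (x :- y)) refl θ θ₀ x x′) x-x′) q p)
      (inj₂ p) (inj₁ q) → inj₂ (integer-+ (trans
        (solve 4 (λ t s x y → t :- y :+ (s :+ x) := t :+ s :+ (x :- y)) refl θ θ₀ x x′) x-x′) q p)
      (inj₁ p) (inj₂ q) → inj₂ (integer-+ (trans
        (solve 4 (λ t s x y → t :+ y :+ (s :- x) := t :+ s :+ (y :- x)) refl θ θ₀ x x′) x′-x) q p)
      (inj₂ p) (inj₂ q) → inj₁ (integer-- (trans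
        (solve 4 (λ t s x y → t :+ y :- (s :+ x) := t :- s :+ (y :- x)) refl θ θ₀ x x′) x′-x) q p)
    where
    x-x′ : ∀ {u} → u + (x - x′) ≈ u
    x-x′ = trans (+-congˡ (trans (+-congʳ x≈x′) (-‿inverseʳ x′))) (+-identityʳ _)
    x′-x : ∀ {u} → u + (x′ - x) ≈ u
    x′-x = trans (+-congˡ (trans (+-congˡ (-‿cong x≈x′)) (-‿inverseʳ x′))) (+-identityʳ _)

  interlaced-sound : ∀ s s′ → InterlacedForm s s′ → Interlaced s s′
  interlaced-sound s s′ (p , q) =
    <-by (⟦⟧>0 (weightForm s′ ℤ[ψ]- weightForm s) p) (sym (trans
      (⟦⟧-sub (weightForm s′) (weightForm s)) (+-cong (weight≈ s′) (-‿cong (weight≈ s))))) ,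
    <-by (⟦⟧>0 (weightForm (next s) ℤ[ψ]- weightForm s′) q) (sym (trans
      (⟦⟧-sub (weightForm (next s)) (weightForm s′)) (+-cong (weight≈ (next s)) (-‿cong (weight≈ s′)))))

  -- Comparison with all leaves and the choice of M.

  BeatsOther : Node → Node → ℕ → Set
  BeatsOther n n′ k = key n ≡ key n′ ⊎ Beats (next^ k (Node.denominators n)) (Node.denominators n′)

  beats-others : ∀ n → GoldenLeaf n → All (Distinguished n) leaves →
                 Eventually (λ k → All (λ n′ → BeatsOther n n′ k) leaves)
  beats-others n (_ , _ , small , _) distinguished =
    eventually-All (All.zipWith (λ {n′} (l , d) → other n′ l d) (leaves-golden , distinguished))
    where
    other : ∀ n′ → GoldenLeaf n′ → Distinguished n n′ → Eventually (BeatsOther n n′)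
    other n′ _ (inj₁ same) = 0 , λ _ _ → inj₁ same
    other n′ (pos′ , _ , small′ , _) (inj₂ shifts) =
      let (i , shifts′)    = Any.satisfied shifts
          (j , interlaced) = Any.satisfied shifts′
          s = Node.denominators n
          s′ = Node.denominators n′
      in eventually-map (λ _ → inj₂) (beats s s′ i j (small-error s small) (small-error s′ small′) pos′
        (interlaced-sound (next^ i s) (next^ j s′) interlaced))

  minimiser : ∀ (S : Carrier → Set) → (∀ {θ} → S θ → Bounded θ) → ∀ θ₀ → S θ₀ → ∀ N →
    ∃[ M ] (N ℕ.< M) ×
      (∀ θ → S θ → ¬ IsInteger (θ - θ₀) → ¬ IsInteger (θ + θ₀) → D[≤ M ] θ₀ < D[≤ M ] θ)
  minimiser S bounded θ₀ θ₀∈S N =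
    let (x₀ , same₀ , P) = classify (bounded θ₀∈S)
    in from-leaf same₀ leaves-golden leaves-distinguished P
    where
    Goal = ∃[ M ] (N ℕ.< M) ×
      (∀ θ → S θ → ¬ IsInteger (θ - θ₀) → ¬ IsInteger (θ + θ₀) → D[≤ M ] θ₀ < D[≤ M ] θ)

    at-leaf : ∀ {x₀} n → SameDistance θ₀ x₀ → GoldenLeaf n → All (Distinguished n) leaves →
              Profile θ₀ x₀ n → Goal
    at-leaf {x₀} n same₀ leaf@(pos , _ , small , _) distinguished P =
      let (K , h) = eventually-×
            (value-bounds s (isGolden P) (small-error s small) pos (early P))
            (beats-others n leaf distinguished)
      in at-level (K ℕ.+ suc N) (ℕ.m≤n+m (suc N) K) (h (K ℕ.+ suc N) (ℕ.m≤m+n K (suc N)))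
      where
      s = Node.denominators n

      at-level : ∀ k → N ℕ.< k →
        (∀ m → 1 ℕ.≤ m → 3 ℕ.+ m ℕ.≤ total (next (next^ k s)) →
          scaledGap θ₀ m ≤ value (next^ k s) (shrink k (X P))) ×
        All (λ n′ → BeatsOther n n′ k) leaves → Goal
      at-level k N<k conditions = M , N<M , compare-with
       where
       t = next^ k s

       k+3≤ : 3 ℕ.+ k ℕ.≤ total (next t)
       k+3≤ = ℕ.≤-trans (ℕ.≤-trans (ℕ.+-monoʳ-≤ 1 (ℕ.≤-trans (ℕ.≤-reflexive (ℕ.+-comm 2 k))
           (ℕ.+-monoʳ-≤ k (ℕ.+-mono-≤ (proj₁ pos) (proj₂ pos)))))
         (total-next^ (suc k) s pos)) (ℕ.≤-reflexive (≡.cong total (next^-suc k s)))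

       -- The last index before the pair of `next t` contributes its value at M + 1. Writing M as k
       -- plus a remainder makes N < M follow from N < k.
       M = k ℕ.+ proj₁ (ℕ.m≤n⇒∃[o]m+o≡n k+3≤)
       3+M≡ : 3 ℕ.+ M ≡ total (next t)
       3+M≡ = proj₂ (ℕ.m≤n⇒∃[o]m+o≡n k+3≤)
       N<M : N ℕ.< M
       N<M = ℕ.≤-trans N<k (ℕ.m≤m+n k _)

       compare-with : ∀ θ → S θ → ¬ IsInteger (θ - θ₀) → ¬ IsInteger (θ + θ₀) → D[≤ M ] θ₀ < D[≤ M ] θ
       compare-with θ θ∈S ¬- ¬+ =
         let (x₀′ , same′ , P′) = classify (bounded θ∈S) in against same′ (proj₂ conditions) P′
         where
         against : ∀ {x₀′ ns} → SameDistance θ x₀′ → All (λ n′ → BeatsOther n n′ k) ns →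
                   Any (Profile θ x₀′) ns → D[≤ M ] θ₀ < D[≤ M ] θ
         against same′ (inj₁ key≡ ∷ _) (here P′) =
           ⊥-elim ([ ¬- , ¬+ ] (sameDistance⇒integer (same-leaf key≡ P P′) same₀ same′))
         against {ns = n′ ∷ _} same′ (inj₂ b ∷ _) (here P′) =
           D-< t (Node.denominators n′) (reciprocal-next^ k s (reciprocal (isGolden P)))
             (isGolden P′) 3+M≡ (ℕ.≤-trans (ℕ.s≤s ℕ.z≤n) N<M) (proj₁ conditions) b
         against same′ (_ ∷ bs) (there P′) = against same′ bs P′

    from-leaf : ∀ {x₀ ns} → SameDistance θ₀ x₀ → All GoldenLeaf ns →
                All (λ n → All (Distinguished n) leaves) ns → Any (Profile θ₀ x₀) ns → Goal
    from-leaf same₀ (l ∷ _)  (d ∷ _)  (here P)  = at-leaf _ same₀ l d P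
    from-leaf same₀ (_ ∷ ls) (_ ∷ ds) (there P) = from-leaf same₀ ls ds P

-- From √5 to ψ and c.

module SquareRootOfFive (ℝ : CompleteOrderedField) where
  open CompleteOrderedField ℝ
  open Dispersion ℝ
  open OrderedField ℝ
  open ℤ-Solver

  # : ∀ {n} → ℕ → Polynomial n
  # k = con (+ k)

  square-cancel-≤ : ∀ {x y} → y >0 → x >0 → x * x ≤ y * y → x ≤ y
  square-cancel-≤ {x} {y} y>0 x>0 x²≤y² = ≮⇒≥ λ y<x → <⇒≱
    (<-by ((y>0 +₊ inj₁ x>0) *₊ <⇒>0 y<x)
      (solve 2 (λ x y → x :* x :- y :* y := (y :+ x) :* (x :- y)) refl x y)) x²≤y²

  square-injective : ∀ {x y} → x >0 → y >0 → x * x ≈ y * y → x ≈ y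
  square-injective x>0 y>0 eq = ≤-antisym (square-cancel-≤ y>0 x>0 (inj₂ eq))
                                          (square-cancel-≤ x>0 y>0 (inj₂ (sym eq)))

  *-cancelˡ : ∀ {x y z} → x >0 → x * y ≈ x * z → y ≈ z
  *-cancelˡ x>0 eq = ≤-antisym (*-cancelˡ-≤ x>0 (inj₂ eq)) (*-cancelˡ-≤ x>0 (inj₂ (sym eq)))

  module _ {r} (√5 : IsPositiveSqrt (5 ⋆ 1#) r) where
    private
      r>0  = proj₁ √5
      r²≈5 = proj₂ √5
      half = inverse (2 ⋆ 1#) (>0⇒≉0 (1+n>0 1))
      h    = proj₁ half
      2h≈1 = proj₂ half

    ψ : Carrier
    ψ = (r - 1#) * h

    2ψ≈r-1 : 2 ⋆ 1# * ψ ≈ r - 1#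
    2ψ≈r-1 = trans (solve 3 (λ r o h → # 2 :* ((r :- o) :* h) := (r :- o) :* (# 2 :* h)) refl r 1# h)
      (trans (*-congˡ 2h≈1) (*-identityʳ _))

    ψ>0 : ψ >0
    ψ>0 = *-cancelˡ-< (1+n>0 1) (<-respʳ-≈ (sym 2ψ≈r-1) (<-respˡ-≈ (sym (zeroʳ _)) (<⇒>0 1<r)))
      where
      1<r : 1# < r
      1<r with ≤∨> r 1#
      ... | inj₂ p = p
      ... | inj₁ p = contradiction
        (≤-by (≤⇒≥0 p *₀ (inj₁ 1>0 +₀ inj₁ r>0))
          (trans (+-congˡ (-‿cong (sym r²≈5)))
            (trans (+-congʳ (sym (*-identityʳ 1#)))
              (solve 2 (λ r o → o :* o :- r :* r := (o :- r) :* (o :+ r)) refl r 1#))))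
        (<⇒≱ (<-by (1+n>0 3) (solve 1 (λ o → o :+ (o :+ (o :+ (o :+ (o :+ # 0)))) :- o :=
          o :+ (o :+ (o :+ (o :+ # 0)))) refl 1#)))

    ψ²≈1-ψ : ψ * ψ ≈ 1# - ψ
    ψ²≈1-ψ = *-cancelˡ (1+n>0 3) (trans
      (solve 1 (λ p → # 4 :* (p :* p) := (# 2 :* p) :* (# 2 :* p)) refl ψ)
      (trans (*-cong 2ψ≈r-1 2ψ≈r-1)
      (trans (trans (*-cong r-1≈ r-1≈)
        (solve 1 (λ r → (r :- # 1) :* (r :- # 1) := r :* r :+ # 1 :- # 2 :* r) refl r))
      (trans (+-congʳ (+-congʳ r²≈5))
      (trans (solve 1 (λ r → # 5 :+ # 1 :- # 2 :* r := # 4 :* # 1 :- # 2 :* (r :- # 1)) refl r)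
      (trans (+-congˡ (-‿cong (*-congˡ (trans (sym r-1≈) (sym 2ψ≈r-1)))))
      (trans (solve 1 (λ p → # 4 :* # 1 :- # 2 :* (# 2 :* p) := # 4 :* (# 1 :- p)) refl ψ)
        (*-congˡ (+-congʳ (+-identityʳ 1#))))))))))
      where
      r-1≈ : r - 1# ≈ r - fromℤ (+ 1)
      r-1≈ = +-congˡ (-‿cong (sym (+-identityʳ 1#)))

    5c≈7+4ψ : ∀ {t} → r * t ≈ 2 ⋆ 1# → 5 ⋆ 1# * (1# + t) ≈ 7 ⋆ 1# + 4 ⋆ 1# * ψ
    5c≈7+4ψ {t} rt≈2 = trans (*-congˡ (+-congʳ (sym (+-identityʳ 1#))))
      (trans (solve 1 (λ t → # 5 :* (# 1 :+ t) := # 5 :+ # 5 :* t) refl t)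
      (trans (+-congˡ (trans (*-congʳ (sym r²≈5)) (trans (*-assoc r r t) (*-congˡ rt≈2))))
      (trans (solve 1 (λ r → # 5 :+ r :* # 2 := # 7 :+ # 2 :* (r :- # 1)) refl r)
      (trans (+-congˡ (*-congˡ (trans (+-congˡ (-‿cong (+-identityʳ 1#))) (sym 2ψ≈r-1))))
        (solve 1 (λ p → # 7 :+ # 2 :* (# 2 :* p) := # 7 :+ # 4 :* p) refl ψ)))))

    goldenNumber : GoldenNumber
    goldenNumber = record { ψ = ψ ; ψ>0 = ψ>0 ; ψ²≈1-ψ = ψ²≈1-ψ }

    criticalValue : ∀ {t} → r * t ≈ 2 ⋆ 1# → CriticalValue goldenNumber
    criticalValue {t} rt≈2 = record { c = 1# + t ; 5c≈7+4ψ = 5c≈7+4ψ rt≈2 }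

  -- Each membership in `𝒮` carries its own r and t; this reduces all of them to a single c.
  2/√5-unique : ∀ {r r′ t t′} → IsPositiveSqrt (5 ⋆ 1#) r → IsPositiveSqrt (5 ⋆ 1#) r′ →
                r * t ≈ 2 ⋆ 1# → r′ * t′ ≈ 2 ⋆ 1# → t ≈ t′
  2/√5-unique (r>0 , r²) (r′>0 , r′²) rt≈2 r′t′≈2 = *-cancelˡ r>0
    (trans rt≈2 (trans (sym r′t′≈2) (*-congʳ (square-injective r′>0 r>0 (trans r′² (sym r²))))))

mainTheorem3 : ExcludedMiddle 0ℓ → (ℝ : CompleteOrderedField) →
    let open CompleteOrderedField ℝ
        open Dispersion ℝ in
    ∀ θ₀ → θ₀ ∈ 𝒮 → ∀ (N : ℕ) → ∃[ M ] (N ℕ.< M) ×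
      (∀ θ → θ ∈ 𝒮 → ¬ IsInteger (θ - θ₀) → ¬ IsInteger (θ + θ₀) →
        D[≤ M ] θ₀ < D[≤ M ] θ)
mainTheorem3 em ℝ θ₀ θ₀∈𝒮@(r , t , √5 , rt≈2 , _) = minimiser 𝒮 bounded θ₀ θ₀∈𝒮
  where
  open CompleteOrderedField ℝ
  open Dispersion ℝ
  open SquareRootOfFive ℝ
  open CriticalDispersion ℝ em (goldenNumber √5) (criticalValue √5 rt≈2)

  bounded : ∀ {θ} → θ ∈ 𝒮 → ∀ m → 1 ℕ.≤ m → scaledGap θ m ≤ 1# + t
  bounded (r′ , t′ , √5′ , r′t′≈2 , upper , _) m 1≤m = ≤-trans (upper _ (m , 1≤m , refl))
    (inj₂ (+-congˡ (2/√5-unique √5′ √5 r′t′≈2 rt≈2)))
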